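{- Let $m\ge n\ge0$ be integers, let $\lambda$ be a partition inside an $n\times m$ board ($n$ rows, $m$ columns), and let $k=\ell(\lambda)$ be its number of nonzero parts. Then $$\begin{bmatrix} m-k\\ n-k\end{bmatrix}H_k^{m+n-k}(\lambda)=q^{k(n-k)}\,[m+n-2k]_{m-k}\,H_k^{m,n}(\lambda),$$ and for every $0\le r<k$, $$\begin{bmatrix} m-r\\ n-r\end{bmatrix}H_r^{m+n-r-1}(\lambda)=q^{r(n-r-1)}\,[m+n-2r-1]_{m-r-1}\,H_r^{m,n}(\lambda)+\sum_{j=r+1}^n q^{r(n-1-j)}\begin{bmatrix} j\\ r\end{bmatrix}\frac{[m+n-r-j-1]_{m-r}}{[n-r]}\,H_j^{m,n}(\lambda).$$
   Context: $q$-notation: $[x]=(1-q^x)/(1-q)$, $[a]_k=[a][a-1]\cdots[a-k+1]$, $[a]!=[a]_a$, $\begin{bmatrix} a\\ b\end{bmatrix}=[a]_b/[b]!$, and $(x;q)_k=\prod_{i=0}^{k-1}(1-xq^i)$; $q$ is an indeterminate. Boards and partitions: cell $(i,j)$ is in row $i$ from the top and column $j$ from the left. A partition $\lambda=(\lambda_1\ge\cdots\ge\lambda_n\ge 0)$ with $\lambda_1\le m$ is identified with the set of cells $(i,j)$ with $j\le\lambda_i$; $|\lambda|$ is its number of cells. $q$-rook numbers: $R_k(\lambda)=\sum_p q^{\mathrm{inv}(p)}$ over all placements $p$ of $k$ non-attacking rooks on cells of $\lambda$ (no two in the same row or column), where $\mathrm{inv}(p)$ is the number of cells of $\lambda$ left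 after each rook cancels its own cell, the cells of $\lambda$ North of it in its column, and the cells West of it in its row. $q$-hit numbers: for $\lambda$ inside an $n\times m$ board with $n\le m$, the $H_i^{m,n}(\lambda)$ are defined by $$\sum_{i=0}^n H_i^{m,n}(\lambda)x^i=\frac{q^{ -|\lambda|}}{[m-n]!}\sum_{i=0}^n R_i(\lambda)\,[m-i]!\,(-1)^i q^{mi-\binom i2}(x;q)_i ,$$ and for square boards $H_i^{N}(\lambda)=H_i^{N,N}(\lambda)$. -}

module Defs where

open import Level using (Level; _⊔_; 0ℓ)
open import Algebra.Bundles using (CommutativeRing)
open import Data.Nat.Base as ℕ using (ℕ; zero; suc; _≤_; _≥_; _∸_)
import Data.Nat.Properties as ℕₚ
open import Data.Nat.Combinatorics using (_C_)
open import Data.Integer.Base as ℤ using (ℤ; +_; -[1+_])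
import Data.Integer.Properties as ℤₚ
open import Data.List.Base as List using (List; []; _∷_; _++_; length; filter; applyUpTo)
open import Data.List.Relation.Unary.All using (All)
open import Data.List.Relation.Unary.Any using (Any; any?)
open import Data.List.Relation.Unary.AllPairs using (AllPairs; allPairs?)
open import Data.List.Relation.Unary.Linked using (Linked)
open import Data.Product.Base using (_×_; _,_; proj₁; proj₂)
open import Data.Sum.Base using (_⊎_; inj₁; inj₂)
open import Relation.Nullary using (¬_; Dec; yes; no; contradiction)
open import Relation.Nullary.Decidable using (¬?; _×-dec_; _⊎-dec_)
open import Relation.Unary using (Decidable)
open import Relation.Binary.PropositionalEquality.Core using (_≡_; _≢_)
import Algebra.Solver.Ring.NaturalCoefficients.Default as Solver
import Algebra.Properties.Ring as RingProperties
import Algebra.Properties.Semiring.Exp as Exp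
import Relation.Binary.Reasoning.Setoid as SetoidReasoning

range : ℕ → ℕ → List ℕ
range a b = applyUpTo (a ℕ.+_) (suc b ∸ a)

module BigOperators {c ℓ} (R : CommutativeRing c ℓ) where
  open CommutativeRing R

  ∑ ∏ : {A : Set} → List A → (A → Carrier) → Carrier
  ∑ xs f = List.foldr (λ a s → f a + s) 0# xs
  ∏ xs f = List.foldr (λ a s → f a * s) 1# xs

  infixr 6.5 ∑ ∏
  syntax ∑ xs (λ a → e) = ∑[ a ∈ xs ] e
  syntax ∏ xs (λ a → e) = ∏[ a ∈ xs ] e

-- Polynomials in one variable are lists of coefficients, constant term
-- first, identified when all their coefficients agree.
module Polynomial {c ℓ} (R : CommutativeRing c ℓ) where
  open CommutativeRing R hiding (zero)
  open RingProperties ring using (-0#≈0#)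

  Poly : Set c
  Poly = List Carrier

  coeff : Poly → ℕ → Carrier
  coeff []      _       = 0#
  coeff (a ∷ p) zero    = a
  coeff (a ∷ p) (suc i) = coeff p i

  infix 4 _≈ᴾ_
  record _≈ᴾ_ (p p′ : Poly) : Set ℓ where
    constructor mk≈
    field at : ∀ i → coeff p i ≈ coeff p′ i
  open _≈ᴾ_ public

  infixl 6 _+ᴾ_
  infixl 7 _*ᴾ_
  infixr 7 _·_

  _+ᴾ_ : Poly → Poly → Poly
  []      +ᴾ p′       = p′
  (a ∷ p) +ᴾ []       = a ∷ p
  (a ∷ p) +ᴾ (b ∷ p′) = (a + b) ∷ (p +ᴾ p′)

  _·_ : Carrier → Poly → Poly
  a · p = List.map (a *_) p

  -ᴾ_ : Poly → Poly
  -ᴾ p = List.map (-_) p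

  _*ᴾ_ : Poly → Poly → Poly
  []      *ᴾ p′ = []
  (a ∷ p) *ᴾ p′ = (a · p′) +ᴾ (0# ∷ (p *ᴾ p′))

  private
    module S = Solver commutativeSemiring
    variable
      a b : Carrier
      p p′ r r′ s : Poly

  ≈ᴾ-refl : p ≈ᴾ p
  ≈ᴾ-refl = mk≈ λ _ → refl

  ≈ᴾ-sym : p ≈ᴾ p′ → p′ ≈ᴾ p
  ≈ᴾ-sym e = mk≈ λ i → sym (at e i)

  ≈ᴾ-trans : p ≈ᴾ r → r ≈ᴾ s → p ≈ᴾ s
  ≈ᴾ-trans e f = mk≈ λ i → trans (at e i) (at f i)

  coeff-+ : ∀ p p′ i → coeff (p +ᴾ p′) i ≈ coeff p i + coeff p′ i
  coeff-+ []      p′       i       = sym (+-identityˡ _)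
  coeff-+ (a ∷ p) []       i       = sym (+-identityʳ _)
  coeff-+ (a ∷ p) (b ∷ p′) zero    = refl
  coeff-+ (a ∷ p) (b ∷ p′) (suc i) = coeff-+ p p′ i

  coeff-· : ∀ a p i → coeff (a · p) i ≈ a * coeff p i
  coeff-· a []      i       = sym (zeroʳ a)
  coeff-· a (b ∷ p) zero    = refl
  coeff-· a (b ∷ p) (suc i) = coeff-· a p i

  coeff-- : ∀ p i → coeff (-ᴾ p) i ≈ - coeff p i
  coeff-- []      i       = sym -0#≈0#
  coeff-- (a ∷ p) zero    = refl
  coeff-- (a ∷ p) (suc i) = coeff-- p i

  ∷-cong : a ≈ b → p ≈ᴾ p′ → (a ∷ p) ≈ᴾ (b ∷ p′)
  ∷-cong e f = mk≈ λ { zero → e ; (suc i) → at f i }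

  0∷[] : (0# ∷ []) ≈ᴾ []
  0∷[] = mk≈ λ { zero → refl ; (suc i) → refl }

  +ᴾ-cong : p ≈ᴾ p′ → r ≈ᴾ r′ → p +ᴾ r ≈ᴾ p′ +ᴾ r′
  +ᴾ-cong {p} {p′} {r} {r′} e f = mk≈ λ i →
    trans (coeff-+ p r i) (trans (+-cong (at e i) (at f i)) (sym (coeff-+ p′ r′ i)))

  +ᴾ-assoc : ∀ p r s → (p +ᴾ r) +ᴾ s ≈ᴾ p +ᴾ (r +ᴾ s)
  +ᴾ-assoc p r s = mk≈ λ i → begin
    coeff ((p +ᴾ r) +ᴾ s) i                ≈⟨ coeff-+ (p +ᴾ r) s i ⟩
    coeff (p +ᴾ r) i + coeff s i           ≈⟨ +-congʳ (coeff-+ p r i) ⟩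
    (coeff p i + coeff r i) + coeff s i    ≈⟨ +-assoc _ _ _ ⟩
    coeff p i + (coeff r i + coeff s i)    ≈⟨ +-congˡ (coeff-+ r s i) ⟨
    coeff p i + coeff (r +ᴾ s) i           ≈⟨ coeff-+ p (r +ᴾ s) i ⟨
    coeff (p +ᴾ (r +ᴾ s)) i                ∎
    where open SetoidReasoning setoid

  +ᴾ-comm : ∀ p r → p +ᴾ r ≈ᴾ r +ᴾ p
  +ᴾ-comm p r = mk≈ λ i →
    trans (coeff-+ p r i) (trans (+-comm _ _) (sym (coeff-+ r p i)))

  +ᴾ-identityʳ : ∀ p → p +ᴾ [] ≈ᴾ p
  +ᴾ-identityʳ p = mk≈ λ i → trans (coeff-+ p [] i) (+-identityʳ _)

  -ᴾ-cong : p ≈ᴾ p′ → -ᴾ p ≈ᴾ -ᴾ p′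
  -ᴾ-cong {p} {p′} e = mk≈ λ i →
    trans (coeff-- p i) (trans (-‿cong (at e i)) (sym (coeff-- p′ i)))

  -ᴾ-inverseʳ : ∀ p → p +ᴾ (-ᴾ p) ≈ᴾ []
  -ᴾ-inverseʳ p = mk≈ λ i →
    trans (coeff-+ p (-ᴾ p) i) (trans (+-congˡ (coeff-- p i)) (-‿inverseʳ _))

  ·-cong : a ≈ b → p ≈ᴾ p′ → a · p ≈ᴾ b · p′
  ·-cong {a} {b} {p} {p′} e f = mk≈ λ i →
    trans (coeff-· a p i) (trans (*-cong e (at f i)) (sym (coeff-· b p′ i)))

  ·-distribˡ : ∀ a p r → a · (p +ᴾ r) ≈ᴾ a · p +ᴾ a · r
  ·-distribˡ a p r = mk≈ λ i → begin
    coeff (a · (p +ᴾ r)) i               ≈⟨ coeff-· a (p +ᴾ r) i ⟩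
    a * coeff (p +ᴾ r) i                 ≈⟨ *-congˡ (coeff-+ p r i) ⟩
    a * (coeff p i + coeff r i)          ≈⟨ distribˡ a _ _ ⟩
    a * coeff p i + a * coeff r i        ≈⟨ +-cong (coeff-· a p i) (coeff-· a r i) ⟨
    coeff (a · p) i + coeff (a · r) i    ≈⟨ coeff-+ (a · p) (a · r) i ⟨
    coeff (a · p +ᴾ a · r) i             ∎
    where open SetoidReasoning setoid

  ·-distribʳ : ∀ a b p → (a + b) · p ≈ᴾ a · p +ᴾ b · p
  ·-distribʳ a b p = mk≈ λ i → begin
    coeff ((a + b) · p) i                ≈⟨ coeff-· (a + b) p i ⟩
    (a + b) * coeff p i                  ≈⟨ distribʳ _ a b ⟩
    a * coeff p i + b * coeff p i        ≈⟨ +-cong (coeff-· a p i) (coeff-· b p i) ⟨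
    coeff (a · p) i + coeff (b · p) i    ≈⟨ coeff-+ (a · p) (b · p) i ⟨
    coeff (a · p +ᴾ b · p) i             ∎
    where open SetoidReasoning setoid

  ·-assoc : ∀ a b p → (a * b) · p ≈ᴾ a · (b · p)
  ·-assoc a b p = mk≈ λ i → begin
    coeff ((a * b) · p) i    ≈⟨ coeff-· (a * b) p i ⟩
    a * b * coeff p i        ≈⟨ *-assoc a b _ ⟩
    a * (b * coeff p i)      ≈⟨ *-congˡ (coeff-· b p i) ⟨
    a * coeff (b · p) i      ≈⟨ coeff-· a (b · p) i ⟨
    coeff (a · (b · p)) i    ∎
    where open SetoidReasoning setoid

  0·p : ∀ p → 0# · p ≈ᴾ []
  0·p p = mk≈ λ i → trans (coeff-· 0# p i) (zeroˡ _)

  1·p : ∀ p → 1# · p ≈ᴾ p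
  1·p p = mk≈ λ i → trans (coeff-· 1# p i) (*-identityˡ _)

  +ᴾ-interchange : ∀ p p′ r r′ → (p +ᴾ p′) +ᴾ (r +ᴾ r′) ≈ᴾ (p +ᴾ r) +ᴾ (p′ +ᴾ r′)
  +ᴾ-interchange p p′ r r′ = mk≈ λ i → begin
    coeff ((p +ᴾ p′) +ᴾ (r +ᴾ r′)) i                       ≈⟨ expand p p′ r r′ i ⟩
    (coeff p i + coeff p′ i) + (coeff r i + coeff r′ i)    ≈⟨ S.solve 4 (λ w x y z →
        (w S.:+ x) S.:+ (y S.:+ z) S.:= (w S.:+ y) S.:+ (x S.:+ z)) refl _ _ _ _ ⟩
    (coeff p i + coeff r i) + (coeff p′ i + coeff r′ i)    ≈⟨ expand p r p′ r′ i ⟨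
    coeff ((p +ᴾ r) +ᴾ (p′ +ᴾ r′)) i                       ∎
    where
    open SetoidReasoning setoid
    expand : ∀ p p′ r r′ i → coeff ((p +ᴾ p′) +ᴾ (r +ᴾ r′)) i ≈
                             (coeff p i + coeff p′ i) + (coeff r i + coeff r′ i)
    expand p p′ r r′ i =
      trans (coeff-+ (p +ᴾ p′) (r +ᴾ r′) i) (+-cong (coeff-+ p p′ i) (coeff-+ r r′ i))

  *ᴾ-congˡ : ∀ p → r ≈ᴾ r′ → p *ᴾ r ≈ᴾ p *ᴾ r′
  *ᴾ-congˡ []      e = ≈ᴾ-refl
  *ᴾ-congˡ (a ∷ p) e = +ᴾ-cong (·-cong refl e) (∷-cong refl (*ᴾ-congˡ p e))

  *ᴾ-zeroʳ : ∀ p → p *ᴾ [] ≈ᴾ []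
  *ᴾ-zeroʳ []      = ≈ᴾ-refl
  *ᴾ-zeroʳ (a ∷ p) = ≈ᴾ-trans (∷-cong refl (*ᴾ-zeroʳ p)) 0∷[]

  *ᴾ-∷ʳ : ∀ p b r → p *ᴾ (b ∷ r) ≈ᴾ b · p +ᴾ (0# ∷ (p *ᴾ r))
  *ᴾ-∷ʳ []      b r = ≈ᴾ-sym 0∷[]
  *ᴾ-∷ʳ (a ∷ p) b r = ∷-cong (+-congʳ (*-comm a b))
    (≈ᴾ-trans (+ᴾ-cong ≈ᴾ-refl (*ᴾ-∷ʳ p b r))
    (≈ᴾ-trans (≈ᴾ-sym (+ᴾ-assoc (a · r) (b · p) _))
    (≈ᴾ-trans (+ᴾ-cong (+ᴾ-comm (a · r) (b · p)) ≈ᴾ-refl)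
              (+ᴾ-assoc (b · p) (a · r) _))))

  *ᴾ-comm : ∀ p r → p *ᴾ r ≈ᴾ r *ᴾ p
  *ᴾ-comm []      r = ≈ᴾ-sym (*ᴾ-zeroʳ r)
  *ᴾ-comm (a ∷ p) r =
    ≈ᴾ-trans (+ᴾ-cong ≈ᴾ-refl (∷-cong refl (*ᴾ-comm p r))) (≈ᴾ-sym (*ᴾ-∷ʳ r a p))

  *ᴾ-cong : p ≈ᴾ p′ → r ≈ᴾ r′ → p *ᴾ r ≈ᴾ p′ *ᴾ r′
  *ᴾ-cong {p} {p′} {r} {r′} e f =
    ≈ᴾ-trans (*ᴾ-congˡ p f)
    (≈ᴾ-trans (*ᴾ-comm p r′) (≈ᴾ-trans (*ᴾ-congˡ r′ e) (*ᴾ-comm r′ p′)))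

  *ᴾ-distribʳ : ∀ s p r → (p +ᴾ r) *ᴾ s ≈ᴾ p *ᴾ s +ᴾ r *ᴾ s
  *ᴾ-distribʳ s []      r       = ≈ᴾ-refl
  *ᴾ-distribʳ s (a ∷ p) []      = ≈ᴾ-sym (+ᴾ-identityʳ _)
  *ᴾ-distribʳ s (a ∷ p) (b ∷ r) =
    ≈ᴾ-trans (+ᴾ-cong (·-distribʳ a b s)
                      (∷-cong (sym (+-identityˡ 0#)) (*ᴾ-distribʳ s p r)))
             (+ᴾ-interchange (a · s) (b · s) (0# ∷ (p *ᴾ s)) (0# ∷ (r *ᴾ s)))

  ·-*ᴾ : ∀ a p r → (a · p) *ᴾ r ≈ᴾ a · (p *ᴾ r)
  ·-*ᴾ a []      r = ≈ᴾ-refl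
  ·-*ᴾ a (b ∷ p) r =
    ≈ᴾ-trans (+ᴾ-cong (·-assoc a b r) (∷-cong (sym (zeroʳ a)) (·-*ᴾ a p r)))
             (≈ᴾ-sym (·-distribˡ a (b · r) (0# ∷ (p *ᴾ r))))

  *ᴾ-assoc : ∀ p r s → (p *ᴾ r) *ᴾ s ≈ᴾ p *ᴾ (r *ᴾ s)
  *ᴾ-assoc []      r s = ≈ᴾ-refl
  *ᴾ-assoc (a ∷ p) r s =
    ≈ᴾ-trans (*ᴾ-distribʳ s (a · r) (0# ∷ (p *ᴾ r)))
             (+ᴾ-cong (·-*ᴾ a r s)
               (+ᴾ-cong (0·p s) (∷-cong refl (*ᴾ-assoc p r s))))

  *ᴾ-identityˡ : ∀ p → (1# ∷ []) *ᴾ p ≈ᴾ p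
  *ᴾ-identityˡ p =
    ≈ᴾ-trans (+ᴾ-cong (1·p p) 0∷[]) (+ᴾ-identityʳ p)

  polynomialRing : CommutativeRing c ℓ
  polynomialRing = record
    { Carrier = Poly ; _≈_ = _≈ᴾ_
    ; _+_ = _+ᴾ_ ; _*_ = _*ᴾ_ ; -_ = -ᴾ_ ; 0# = [] ; 1# = 1# ∷ []
    ; isCommutativeRing = record
      { isRing = record
        { +-isAbelianGroup = record
          { isGroup = record
            { isMonoid = record
              { isSemigroup = record
                { isMagma = record
                  { isEquivalence = record { refl = ≈ᴾ-refl ; sym = ≈ᴾ-sym ; trans = ≈ᴾ-trans }
                  ; ∙-cong = +ᴾ-cong }
                ; assoc = +ᴾ-assoc }
              ; identity = (λ _ → ≈ᴾ-refl) , +ᴾ-identityʳ }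
            ; inverse = (λ p → ≈ᴾ-trans (+ᴾ-comm (-ᴾ p) p) (-ᴾ-inverseʳ p)) , -ᴾ-inverseʳ
            ; ⁻¹-cong = -ᴾ-cong }
          ; comm = +ᴾ-comm }
        ; *-cong = *ᴾ-cong
        ; *-assoc = *ᴾ-assoc
        ; *-identity = *ᴾ-identityˡ ,
                       (λ p → ≈ᴾ-trans (*ᴾ-comm p (1# ∷ [])) (*ᴾ-identityˡ p))
        ; distrib = (λ s p r → ≈ᴾ-trans (*ᴾ-comm s (p +ᴾ r))
                      (≈ᴾ-trans (*ᴾ-distribʳ s p r)
                                (+ᴾ-cong (*ᴾ-comm p s) (*ᴾ-comm r s)))) ,
                    *ᴾ-distribʳ
        }
      ; *-comm = *ᴾ-comm
      }
    }

  module _ (≈0? : ∀ a → Dec (a ≈ 0#)) where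

    ≈ᴾ0? : ∀ p → Dec (p ≈ᴾ [])
    ≈ᴾ0? []      = yes ≈ᴾ-refl
    ≈ᴾ0? (a ∷ p) with ≈0? a | ≈ᴾ0? p
    ... | yes a≈0 | yes p≈0 = yes (≈ᴾ-trans (∷-cong a≈0 p≈0) 0∷[])
    ... | no  a≉0 | _       = no λ e → a≉0 (at e zero)
    ... | yes _   | no  p≉0 = no λ e → p≉0 (mk≈ λ i → at e (suc i))

    private
      shift : ∀ {a} p r → a ≈ 0# → (a ∷ p) *ᴾ r ≈ᴾ [] → p *ᴾ r ≈ᴾ []
      shift {a} p r a≈0 e = mk≈ λ i → at (≈ᴾ-trans
        (≈ᴾ-sym (+ᴾ-cong (≈ᴾ-trans (·-cong a≈0 ≈ᴾ-refl) (0·p r)) ≈ᴾ-refl)) e) (suc i)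

    module _ (*-nonzero : ∀ {a b} → ¬ (a ≈ 0#) → ¬ (b ≈ 0#) → ¬ (a * b ≈ 0#)) where

      *ᴾ-nonzero : ∀ p r → ¬ (p ≈ᴾ []) → ¬ (r ≈ᴾ []) → ¬ (p *ᴾ r ≈ᴾ [])
      *ᴾ-nonzero []      r p≉0 = λ _ _ → p≉0 ≈ᴾ-refl
      *ᴾ-nonzero (a ∷ p) r p≉0 = go r
        where
        go : ∀ r → ¬ (r ≈ᴾ []) → ¬ ((a ∷ p) *ᴾ r ≈ᴾ [])
        go []      r≉0 e = r≉0 ≈ᴾ-refl
        go (b ∷ r) r≉0 e with ≈0? a | ≈0? b
        ... | no a≉0  | no b≉0  =
          *-nonzero a≉0 b≉0 (trans (sym (+-identityʳ _)) (at e zero))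
        ... | yes a≈0 | _       =
          *ᴾ-nonzero p (b ∷ r) (λ p≈0 → p≉0 (≈ᴾ-trans (∷-cong a≈0 p≈0) 0∷[])) r≉0
            (shift p (b ∷ r) a≈0 e)
        ... | no _    | yes b≈0 =
          go r (λ r≈0 → r≉0 (≈ᴾ-trans (∷-cong b≈0 r≈0) 0∷[]))
            (≈ᴾ-trans (*ᴾ-comm (a ∷ p) r)
              (shift r (a ∷ p) b≈0 (≈ᴾ-trans (*ᴾ-comm (b ∷ r) (a ∷ p)) e)))

record IsDecidableDomain {c ℓ} (R : CommutativeRing c ℓ) : Set (c ⊔ ℓ) where
  open CommutativeRing R
  field
    ≈0?       : ∀ a → Dec (a ≈ 0#)
    1≉0       : ¬ (1# ≈ 0#)
    *-nonzero : ∀ {a b} → ¬ (a ≈ 0#) → ¬ (b ≈ 0#) → ¬ (a * b ≈ 0#)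

module Fractions {c ℓ} (D : CommutativeRing c ℓ) (isDomain : IsDecidableDomain D) where
  open CommutativeRing D
  open IsDecidableDomain isDomain

  private
    module S = Solver commutativeSemiring
    open RingProperties ring using (-‿distribˡ-*; x∙y⁻¹≈ε⇒x≈y; x[y-z]≈xy-xz)
    open SetoidReasoning setoid

    *-cancelˡ : ∀ {d a b} → ¬ (d ≈ 0#) → d * a ≈ d * b → a ≈ b
    *-cancelˡ {d} {a} {b} d≉0 e with ≈0? (a - b)
    ... | yes a-b≈0 = x∙y⁻¹≈ε⇒x≈y a b a-b≈0
    ... | no  a-b≉0 = contradiction
      (trans (x[y-z]≈xy-xz d a b) (trans (+-congʳ e) (-‿inverseʳ _)))
      (*-nonzero d≉0 a-b≉0)

  record Fraction : Set (c ⊔ ℓ) where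
    constructor mkFrac
    field
      num   : Carrier
      den   : Carrier
      den≉0 : ¬ (den ≈ 0#)
  open Fraction public

  infix 4 _≃_
  record _≃_ (x y : Fraction) : Set ℓ where
    constructor mk≃
    field cross : num x * den y ≈ num y * den x
  open _≃_ public

  infixl 6 _+ᶠ_
  infixl 7 _*ᶠ_
  infix  8 _⁻¹

  _+ᶠ_ _*ᶠ_ : Fraction → Fraction → Fraction
  mkFrac a b b≉0 +ᶠ mkFrac c d d≉0 = mkFrac (a * d + c * b) (b * d) (*-nonzero b≉0 d≉0)
  mkFrac a b b≉0 *ᶠ mkFrac c d d≉0 = mkFrac (a * c) (b * d) (*-nonzero b≉0 d≉0)

  -ᶠ_ : Fraction → Fraction
  -ᶠ mkFrac a b b≉0 = mkFrac (- a) b b≉0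

  embed : Carrier → Fraction
  embed a = mkFrac a 1# 1≉0

  -- With the convention that the inverse of zero is zero.
  _⁻¹ : Fraction → Fraction
  mkFrac a b b≉0 ⁻¹ with ≈0? a
  ... | yes _   = embed 0#
  ... | no  a≉0 = mkFrac b a a≉0

  private
    ≃-trans : ∀ {x y z} → x ≃ y → y ≃ z → x ≃ z
    ≃-trans {mkFrac a b _} {mkFrac c d d≉0} {mkFrac e f _} (mk≃ p) (mk≃ r) =
      mk≃ (*-cancelˡ d≉0 (begin
        d * (a * f)   ≈⟨ S.solve 3 (λ a d f → d S.:* (a S.:* f) S.:= (a S.:* d) S.:* f) refl a d f ⟩
        (a * d) * f   ≈⟨ *-congʳ p ⟩
        (c * b) * f   ≈⟨ S.solve 3 (λ b c f → (c S.:* b) S.:* f S.:= (c S.:* f) S.:* b) refl b c f ⟩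
        (c * f) * b   ≈⟨ *-congʳ r ⟩
        (e * d) * b   ≈⟨ S.solve 3 (λ b d e → (e S.:* d) S.:* b S.:= d S.:* (e S.:* b)) refl b d e ⟩
        d * (e * b)   ∎))

    +ᶠ-cong : ∀ {x x′ y y′} → x ≃ x′ → y ≃ y′ → x +ᶠ y ≃ x′ +ᶠ y′
    +ᶠ-cong {mkFrac a b _} {mkFrac a′ b′ _} {mkFrac c d _} {mkFrac c′ d′ _} (mk≃ p) (mk≃ r) =
      mk≃ (begin
        (a * d + c * b) * (b′ * d′)
          ≈⟨ S.solve 6 (λ a b c d b′ d′ →
               (a S.:* d S.:+ c S.:* b) S.:* (b′ S.:* d′) S.:=
               (a S.:* b′) S.:* (d S.:* d′) S.:+ (c S.:* d′) S.:* (b S.:* b′)) refl a b c d b′ d′ ⟩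
        (a * b′) * (d * d′) + (c * d′) * (b * b′)
          ≈⟨ +-cong (*-congʳ p) (*-congʳ r) ⟩
        (a′ * b) * (d * d′) + (c′ * d) * (b * b′)
          ≈⟨ S.solve 6 (λ a′ b c′ d b′ d′ →
               (a′ S.:* b) S.:* (d S.:* d′) S.:+ (c′ S.:* d) S.:* (b S.:* b′) S.:=
               (a′ S.:* d′ S.:+ c′ S.:* b′) S.:* (b S.:* d)) refl a′ b c′ d b′ d′ ⟩
        (a′ * d′ + c′ * b′) * (b * d) ∎)

    *ᶠ-cong : ∀ {x x′ y y′} → x ≃ x′ → y ≃ y′ → x *ᶠ y ≃ x′ *ᶠ y′
    *ᶠ-cong {mkFrac a b _} {mkFrac a′ b′ _} {mkFrac c d _} {mkFrac c′ d′ _} (mk≃ p) (mk≃ r) =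
      mk≃ (begin
        (a * c) * (b′ * d′)    ≈⟨ interchange a c b′ d′ ⟩
        (a * b′) * (c * d′)    ≈⟨ *-cong p r ⟩
        (a′ * b) * (c′ * d)    ≈⟨ interchange a′ b c′ d ⟩
        (a′ * c′) * (b * d)    ∎)
      where
      interchange : ∀ w x y z → (w * x) * (y * z) ≈ (w * y) * (x * z)
      interchange = S.solve 4 (λ w x y z →
        (w S.:* x) S.:* (y S.:* z) S.:= (w S.:* y) S.:* (x S.:* z)) refl

    -ᶠ-cong : ∀ {x y} → x ≃ y → -ᶠ x ≃ -ᶠ y
    -ᶠ-cong {mkFrac a b _} {mkFrac c d _} (mk≃ p) =
      mk≃ (trans (sym (-‿distribˡ-* a d)) (trans (-‿cong p) (-‿distribˡ-* c b)))

    +ᶠ-assoc : ∀ x y z → (x +ᶠ y) +ᶠ z ≃ x +ᶠ (y +ᶠ z)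
    +ᶠ-assoc (mkFrac a b _) (mkFrac c d _) (mkFrac e f _) = mk≃ (S.solve 6 (λ a b c d e f →
      ((a S.:* d S.:+ c S.:* b) S.:* f S.:+ e S.:* (b S.:* d)) S.:* (b S.:* (d S.:* f)) S.:=
      (a S.:* (d S.:* f) S.:+ (c S.:* f S.:+ e S.:* d) S.:* b) S.:* ((b S.:* d) S.:* f))
      refl a b c d e f)

    +ᶠ-comm : ∀ x y → x +ᶠ y ≃ y +ᶠ x
    +ᶠ-comm (mkFrac a b _) (mkFrac c d _) = mk≃ (S.solve 4 (λ a b c d →
      (a S.:* d S.:+ c S.:* b) S.:* (d S.:* b) S.:=
      (c S.:* b S.:+ a S.:* d) S.:* (b S.:* d)) refl a b c d)

    +ᶠ-identityˡ : ∀ x → embed 0# +ᶠ x ≃ x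
    +ᶠ-identityˡ (mkFrac a b _) = mk≃ (S.solve 2 (λ a b →
      (S.con 0 S.:* b S.:+ a S.:* S.con 1) S.:* b S.:=
      a S.:* (S.con 1 S.:* b)) refl a b)

    -ᶠ-inverseˡ : ∀ x → (-ᶠ x) +ᶠ x ≃ embed 0#
    -ᶠ-inverseˡ (mkFrac a b _) = mk≃ (begin
      (- a * b + a * b) * 1#    ≈⟨ *-identityʳ _ ⟩
      - a * b + a * b           ≈⟨ distribʳ b (- a) a ⟨
      (- a + a) * b             ≈⟨ *-congʳ (-‿inverseˡ a) ⟩
      0# * b                    ≈⟨ zeroˡ b ⟩
      0#                        ≈⟨ zeroˡ (b * b) ⟨
      0# * (b * b)              ∎)

    *ᶠ-assoc : ∀ x y z → (x *ᶠ y) *ᶠ z ≃ x *ᶠ (y *ᶠ z)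
    *ᶠ-assoc (mkFrac a b _) (mkFrac c d _) (mkFrac e f _) = mk≃ (S.solve 6 (λ a b c d e f →
      ((a S.:* c) S.:* e) S.:* (b S.:* (d S.:* f)) S.:=
      (a S.:* (c S.:* e)) S.:* ((b S.:* d) S.:* f)) refl a b c d e f)

    *ᶠ-comm : ∀ x y → x *ᶠ y ≃ y *ᶠ x
    *ᶠ-comm (mkFrac a b _) (mkFrac c d _) = mk≃ (*-cong (*-comm a c) (*-comm d b))

    *ᶠ-identityˡ : ∀ x → embed 1# *ᶠ x ≃ x
    *ᶠ-identityˡ (mkFrac a b _) = mk≃ (S.solve 2 (λ a b →
      (S.con 1 S.:* a) S.:* b S.:= a S.:* (S.con 1 S.:* b)) refl a b)

    *ᶠ-distribʳ : ∀ z x y → (x +ᶠ y) *ᶠ z ≃ x *ᶠ z +ᶠ y *ᶠ z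
    *ᶠ-distribʳ (mkFrac e f _) (mkFrac a b _) (mkFrac c d _) = mk≃ (S.solve 6 (λ a b c d e f →
      ((a S.:* d S.:+ c S.:* b) S.:* e) S.:* ((b S.:* f) S.:* (d S.:* f)) S.:=
      ((a S.:* e) S.:* (d S.:* f) S.:+ (c S.:* e) S.:* (b S.:* f)) S.:* ((b S.:* d) S.:* f))
      refl a b c d e f)

  fractionField : CommutativeRing (c ⊔ ℓ) ℓ
  fractionField = record
    { Carrier = Fraction ; _≈_ = _≃_
    ; _+_ = _+ᶠ_ ; _*_ = _*ᶠ_ ; -_ = -ᶠ_ ; 0# = embed 0# ; 1# = embed 1#
    ; isCommutativeRing = record
      { isRing = record
        { +-isAbelianGroup = record
          { isGroup = record
            { isMonoid = record
              { isSemigroup = record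
                { isMagma = record
                  { isEquivalence = record
                    { refl  = mk≃ refl
                    ; sym   = λ e → mk≃ (sym (cross e))
                    ; trans = ≃-trans }
                  ; ∙-cong = +ᶠ-cong }
                ; assoc = +ᶠ-assoc }
              ; identity = +ᶠ-identityˡ ,
                           (λ x → ≃-trans (+ᶠ-comm x (embed 0#)) (+ᶠ-identityˡ x)) }
            ; inverse = -ᶠ-inverseˡ ,
                        (λ x → ≃-trans (+ᶠ-comm x (-ᶠ x)) (-ᶠ-inverseˡ x))
            ; ⁻¹-cong = -ᶠ-cong }
          ; comm = +ᶠ-comm }
        ; *-cong = *ᶠ-cong
        ; *-assoc = *ᶠ-assoc
        ; *-identity = *ᶠ-identityˡ ,
                       (λ x → ≃-trans (*ᶠ-comm x (embed 1#)) (*ᶠ-identityˡ x))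
        ; distrib = (λ z x y → ≃-trans (*ᶠ-comm z (x +ᶠ y))
                      (≃-trans (*ᶠ-distribʳ z x y)
                               (+ᶠ-cong (*ᶠ-comm x z) (*ᶠ-comm y z)))) ,
                    *ᶠ-distribʳ
        }
      ; *-comm = *ᶠ-comm
      }
    }

  ⁻¹-inverseʳ : ∀ x → ¬ (x ≃ embed 0#) → x *ᶠ x ⁻¹ ≃ embed 1#
  ⁻¹-inverseʳ (mkFrac a b b≉0) x≉0 with ≈0? a
  ... | yes a≈0 = contradiction
    (mk≃ (trans (*-identityʳ a) (trans a≈0 (sym (zeroˡ b))))) x≉0
  ... | no  _   = mk≃ (S.solve 2 (λ a b →
    (a S.:* b) S.:* S.con 1 S.:= S.con 1 S.:* (b S.:* a)) refl a b)

-- ℚ(q) is constructed as the field of fractions of ℤ[q].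
module ℤ[q] = Polynomial ℤₚ.+-*-commutativeRing

private
  ℤ-nonzero : ∀ {i j} → ¬ (i ≡ ℤ.0ℤ) → ¬ (j ≡ ℤ.0ℤ) → ¬ (i ℤ.* j ≡ ℤ.0ℤ)
  ℤ-nonzero {i} i≢0 j≢0 ij≡0 with ℤₚ.i*j≡0⇒i≡0∨j≡0 i ij≡0
  ... | inj₁ i≡0 = i≢0 i≡0
  ... | inj₂ j≡0 = j≢0 j≡0

ℤ[q]-isDomain : IsDecidableDomain ℤ[q].polynomialRing
ℤ[q]-isDomain = record
  { ≈0?       = ℤ[q].≈ᴾ0? (ℤₚ._≟ ℤ.0ℤ)
  ; 1≉0       = λ e → contradiction (ℤ[q]._≈ᴾ_.at e 0) λ ()
  ; *-nonzero = ℤ[q].*ᴾ-nonzero (ℤₚ._≟ ℤ.0ℤ) ℤ-nonzero _ _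
  }

module ℚ⟨q⟩ = Fractions ℤ[q].polynomialRing ℤ[q]-isDomain

K : CommutativeRing 0ℓ 0ℓ
K = ℚ⟨q⟩.fractionField

open CommutativeRing K public
  using (Carrier; _≈_; _+_; _*_; -_; _-_; 0#; 1#)
open ℚ⟨q⟩ public using (_⁻¹; ⁻¹-inverseʳ)
open Exp (CommutativeRing.semiring K) public using (_^_)
open BigOperators K public

infixl 7 _/_
_/_ : Carrier → Carrier → Carrier
x / y = x * y ⁻¹

q : Carrier
q = ℚ⟨q⟩.embed (ℤ.0ℤ ∷ ℤ.1ℤ ∷ [])

infix 9 q^_
q^_ : ℤ → Carrier
q^ (+ a)      = q ^ a
q^ (-[1+ a ]) = (q ^ suc a) ⁻¹

[_] : ℕ → Carrier
[ a ] = (1# - q ^ a) / (1# - q)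

-- [a][a-1]⋯[a-k+1]; truncated subtraction is harmless, since for k > a
-- the factor [0] = 0 occurs.
[_]↓_ : ℕ → ℕ → Carrier
[ a ]↓ k = ∏[ i ∈ List.upTo k ] [ a ∸ i ]

[_]! : ℕ → Carrier
[ a ]! = [ a ]↓ a

[_choose_] : ℕ → ℕ → Carrier
[ a choose b ] = ([ a ]↓ b) / [ b ]!

-- Trailing zero parts are allowed and do not affect the set of cells.
record Partition : Set where
  field
    parts      : List ℕ
    decreasing : Linked _≥_ parts
open Partition public

ℓ : Partition → ℕ
ℓ μ = length (filter (1 ℕₚ.≤?_) (parts μ))

-- The n × m board has n rows and m columns.
Inside : ℕ → ℕ → Partition → Set
Inside n m μ = ℓ μ ≤ n × All (_≤ m) (parts μ)

-- (row from the top, column from the left), both starting at 1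
Cell : Set
Cell = ℕ × ℕ

row col : Cell → ℕ
row = proj₁
col = proj₂

rowsFrom : ℕ → List ℕ → List Cell
rowsFrom i []       = []
rowsFrom i (l ∷ ls) = List.map (i ,_) (range 1 l) ++ rowsFrom (suc i) ls

cells : Partition → List Cell
cells μ = rowsFrom 1 (parts μ)

∣_∣ : Partition → ℕ
∣ μ ∣ = length (cells μ)

-- The sublists of length k; for a list without repetitions these are its
-- k-element subsets, each listed once.
sublistsOfLength : {A : Set} → ℕ → List A → List (List A)
sublistsOfLength zero    xs       = [] ∷ []
sublistsOfLength (suc k) []       = []
sublistsOfLength (suc k) (x ∷ xs) =
  List.map (x ∷_) (sublistsOfLength k xs) ++ sublistsOfLength (suc k) xs

NonAttacking : List Cell → Set
NonAttacking = AllPairs λ c d → row c ≢ row d × col c ≢ col d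

nonAttacking? : Decidable NonAttacking
nonAttacking? = allPairs? λ c d → ¬? (row c ℕₚ.≟ row d) ×-dec ¬? (col c ℕₚ.≟ col d)

placements : ℕ → Partition → List (List Cell)
placements k μ = filter nonAttacking? (sublistsOfLength k (cells μ))

-- North and West are taken weakly, so that a rook also cancels its own cell.
Cancels : Cell → Cell → Set
Cancels rook c = (col c ≡ col rook × row c ≤ row rook)
               ⊎ (row c ≡ row rook × col c ≤ col rook)

cancels? : ∀ rook c → Dec (Cancels rook c)
cancels? rook c = ((col c ℕₚ.≟ col rook) ×-dec (row c ℕₚ.≤? row rook))
            ⊎-dec ((row c ℕₚ.≟ row rook) ×-dec (col c ℕₚ.≤? col rook))

inv : Partition → List Cell → ℕ
inv μ p = length (filter (λ c → ¬? (any? (λ rook → cancels? rook c) p)) (cells μ))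

R : ℕ → Partition → Carrier
R k μ = ∑[ p ∈ placements k μ ] q ^ inv μ p

module K[x] where
  open Polynomial K public using (Poly; coeff; _·_; polynomialRing)
  open BigOperators polynomialRing public

-- (x;q)ₖ as a polynomial in x
x-qPochhammer : ℕ → K[x].Poly
x-qPochhammer k = K[x].∏ (List.upTo k) λ i → 1# ∷ - (q ^ i) ∷ []

-- The right-hand side of the identity, in powers of x, that defines the
-- q-hit numbers of an n × m board with n ≤ m (superscripts m,n in this order).
hitPolynomial : ℕ → ℕ → Partition → K[x].Poly
hitPolynomial m n μ =
  (q^ (ℤ.- + ∣ μ ∣) / [ m ∸ n ]!) K[x].·
    K[x].∑ (range 0 n) λ i →
      (R i μ * [ m ∸ i ]! * (- 1#) ^ i * q^ (+ (m ℕ.* i) ℤ.- + (i C 2))) K[x].· x-qPochhammer i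

H : ℕ → ℕ → ℕ → Partition → Carrier
H m n i μ = K[x].coeff (hitPolynomial m n μ) i

H□ : ℕ → ℕ → Partition → Carrier
H□ N = H N N

{-# OPTIONS --safe #-}
module Submission where

-- Why the theorem holds.  For an arbitrary sequence of numbers R(i) in place
-- of the rook numbers, every hit number H(j) is a linear combination of the
-- R(i), with the coefficient c(i,j) of x^j in (x;q)_i as a factor:
--
--   H(j) = const * sum over i of
--            R(i) [m-i]! (-1)^i q^(m i - binom(i,2)) c(i,j) / [m-n]!.
--
-- The one fact needed about rook placements is that R(i) = 0 when i exceeds
-- the number of nonzero rows (R-zero), since non-attacking rooks lie in
-- distinct rows.  It lets the sum that defines the hit numbers of the larger
-- square board stop at n.  In the first identity it leaves only i = k, since
-- c(i,k) = 0 for i < k, and there both sides have the same quotient of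
-- q-factorials as coefficient (top-term).
--
-- The second identity holds coefficient by coefficient: the two sides have
-- the same coefficient of each R(i) with i at most n.  For i < r both are
-- zero.  For i = r + s the factorisation
--
--   c(r+s,r+t) [r+t choose r] = q^(r t) c(r+s,r) c(s,t)
--
-- (pochhammer-trinomial) takes c(r+s,r) out of the sum over j = r + t, and
-- the isolated first term on the right becomes the term t = 0.  With a = m-r
-- and e = n-r-1 what remains is
--
--   sum over t of c(s,t) [a+e-t]_a = q^(e s) [a]_s [a-s+e]_(a-s).
--
-- Since (x;q)_(s+1) = (1 - q^s x) (x;q)_s, the left side is an s-fold
-- q-difference, and the evaluation is an induction on s (Δ-↓) that repeatedly
-- applies [a+1+e]_(a+1) - [a+e]_(a+1) = q^e [a+1] [a+e]_a (↓-difference).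
--
-- The algebra takes place in any commutative ring with inverses of its
-- nonzero elements in which [1], [2], ... are nonzero.  At the end it is
-- applied to the field of rational functions, where q is nonzero and not a root
-- of unity (q≉0, q^suc≉1).

open import Defs using (range; module BigOperators; module Polynomial)
import Level
open import Algebra.Bundles using (CommutativeRing)
import Algebra.Properties.Ring as RingProperties
import Algebra.Properties.Semiring.Exp as Exp
import Algebra.Solver.Ring.NaturalCoefficients.Default as Solver
open import Data.Integer.Base as ℤ using (ℤ; +_; -[1+_])
import Data.Integer.Properties as ℤₚ
import Data.Integer.Tactic.RingSolver as ℤ-Solver
open import Data.List.Base as List using (List; []; _∷_; _++_; length; filter; applyUpTo; upTo)
open import Data.List.Properties using (filter-none)
open import Data.List.Relation.Binary.Sublist.Propositional using (_⊆_; []; _∷_; _∷ʳ_; minimum)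
open import Data.List.Relation.Unary.All as All using (All; []; _∷_)
import Data.List.Relation.Unary.All.Properties as Allₚ
open import Data.List.Relation.Unary.AllPairs using ([]; _∷_)
open import Data.Nat.Base as ℕ using (ℕ; zero; suc; _≤_; _<_; _∸_; z≤n; s≤s)
open import Data.Nat.Combinatorics using (_C_)
import Data.Nat.Properties as ℕₚ
import Data.Nat.Tactic.RingSolver as ℕ-Solver
open import Data.Product.Base using (_×_; _,_; proj₁)
open import Data.Sum.Base using (inj₁; inj₂)
open import Function.Base using (_∘_)
open import Relation.Binary.Definitions using (tri<; tri≈; tri>)
open import Relation.Binary.PropositionalEquality as ≡ using (_≡_; _≢_)
import Relation.Binary.Reasoning.Setoid as SetoidReasoning
open import Relation.Nullary using (¬_; contradiction)

-- Finite sums and products in a commutative ring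

module BigOperatorProperties {c ℓ} (F : CommutativeRing c ℓ) where
  open CommutativeRing F hiding (zero)
  open BigOperators F
  open SetoidReasoning setoid
  open Solver commutativeSemiring using (solve; _:=_; _:*_; _:+_)

  ∏-snoc : ∀ {A : Set} (h : ℕ → A) n f →
           ∏ (applyUpTo h (suc n)) f ≈ ∏ (applyUpTo h n) f * f (h n)
  ∏-snoc h zero    f = *-comm _ _
  ∏-snoc h (suc n) f = trans (*-congˡ (∏-snoc (h ∘ suc) n f)) (sym (*-assoc _ _ _))

  ∏-applyUpTo-cong : ∀ {A B : Set} (h : ℕ → A) (h′ : ℕ → B) f f′ n →
    (∀ i → f (h i) ≈ f′ (h′ i)) → ∏ (applyUpTo h n) f ≈ ∏ (applyUpTo h′ n) f′
  ∏-applyUpTo-cong h h′ f f′ zero    e = refl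
  ∏-applyUpTo-cong h h′ f f′ (suc n) e =
    *-cong (e 0) (∏-applyUpTo-cong (h ∘ suc) (h′ ∘ suc) f f′ n (e ∘ suc))

  ∑-applyUpTo-cong : ∀ {A B : Set} (h : ℕ → A) (h′ : ℕ → B) f f′ n →
    (∀ i → i < n → f (h i) ≈ f′ (h′ i)) → ∑ (applyUpTo h n) f ≈ ∑ (applyUpTo h′ n) f′
  ∑-applyUpTo-cong h h′ f f′ zero    e = refl
  ∑-applyUpTo-cong h h′ f f′ (suc n) e = +-cong (e 0 (s≤s z≤n))
    (∑-applyUpTo-cong (h ∘ suc) (h′ ∘ suc) f f′ n (λ i i<n → e (suc i) (s≤s i<n)))

  ∑-zero : ∀ {A : Set} (xs : List A) f → (∀ x → f x ≈ 0#) → ∑ xs f ≈ 0#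
  ∑-zero []       f e = refl
  ∑-zero (x ∷ xs) f e = trans (+-cong (e x) (∑-zero xs f e)) (+-identityˡ 0#)

  ∑-cong : ∀ {A : Set} (xs : List A) {f f′} → (∀ x → f x ≈ f′ x) → ∑ xs f ≈ ∑ xs f′
  ∑-cong []       e = refl
  ∑-cong (x ∷ xs) e = +-cong (e x) (∑-cong xs e)

  ∑-truncate : ∀ {A : Set} (h : ℕ → A) f n k → (∀ i → n ≤ i → f (h i) ≈ 0#) →
               ∑ (applyUpTo h (n ℕ.+ k)) f ≈ ∑ (applyUpTo h n) f
  ∑-truncate h f zero    zero    e = refl
  ∑-truncate h f zero    (suc k) e = trans
    (+-cong (e 0 z≤n) (∑-truncate (h ∘ suc) f zero k (λ i _ → e (suc i) z≤n))) (+-identityˡ 0#)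
  ∑-truncate h f (suc n) k       e =
    +-congˡ (∑-truncate (h ∘ suc) f n k (λ i n≤i → e (suc i) (s≤s n≤i)))

  ∑-+ : ∀ {A : Set} (xs : List A) f g → (∑[ x ∈ xs ] (f x + g x)) ≈ ∑ xs f + ∑ xs g
  ∑-+ []       f g = sym (+-identityˡ 0#)
  ∑-+ (x ∷ xs) f g = trans (+-congˡ (∑-+ xs f g)) (solve 4 (λ a b s t →
    (a :+ b) :+ (s :+ t) := (a :+ s) :+ (b :+ t)) refl _ _ _ _)

  ∑-*ˡ : ∀ {A : Set} (xs : List A) a f → a * ∑ xs f ≈ ∑[ x ∈ xs ] a * f x
  ∑-*ˡ []       a f = zeroʳ a
  ∑-*ˡ (x ∷ xs) a f = trans (distribˡ a _ _) (+-congˡ (∑-*ˡ xs a f))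

  ∑-swap : ∀ {A B : Set} (xs : List A) (ys : List B) (f : A → B → Carrier) →
           (∑[ x ∈ xs ] ∑[ y ∈ ys ] f x y) ≈ ∑[ y ∈ ys ] ∑[ x ∈ xs ] f x y
  ∑-swap []       ys f = sym (∑-zero ys _ (λ _ → refl))
  ∑-swap (x ∷ xs) ys f = trans (+-congˡ (∑-swap xs ys f)) (sym (∑-+ ys _ _))

  -- A linear combination of sums that share the weights w, as one weighted sum.
  ∑-collect : ∀ {A B : Set} (xs : List A) (ys : List B) (w : A → Carrier) α (β : B → Carrier)
              (f : A → Carrier) (g : A → B → Carrier) →
    α * (∑[ x ∈ xs ] w x * f x) + (∑[ y ∈ ys ] β y * (∑[ x ∈ xs ] w x * g x y)) ≈
    ∑[ x ∈ xs ] w x * (α * f x + ∑[ y ∈ ys ] β y * g x y)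
  ∑-collect xs ys w α β f g = begin
    α * (∑[ x ∈ xs ] w x * f x) + (∑[ y ∈ ys ] β y * (∑[ x ∈ xs ] w x * g x y))
      ≈⟨ +-cong (∑-*ˡ xs α _) (trans (∑-cong ys (λ y → ∑-*ˡ xs (β y) _)) (∑-swap ys xs _)) ⟩
    (∑[ x ∈ xs ] α * (w x * f x)) + (∑[ x ∈ xs ] ∑[ y ∈ ys ] β y * (w x * g x y))
      ≈⟨ ∑-+ xs _ _ ⟨
    (∑[ x ∈ xs ] (α * (w x * f x) + ∑[ y ∈ ys ] β y * (w x * g x y)))
      ≈⟨ ∑-cong xs (λ x → trans
           (+-cong (swap α (w x) (f x)) (trans (∑-cong ys (λ y → swap (β y) (w x) (g x y))) (sym (∑-*ˡ ys (w x) _))))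
           (sym (distribˡ (w x) _ _))) ⟩
    (∑[ x ∈ xs ] w x * (α * f x + ∑[ y ∈ ys ] β y * g x y)) ∎
    where
    swap : ∀ a b c → a * (b * c) ≈ b * (a * c)
    swap = solve 3 (λ a b c → a :* (b :* c) := b :* (a :* c)) refl

-- q-integers and q-factorials

-- A commutative ring in which every nonzero element has an inverse, with an
-- element q and a sequence [0], [1], [2], … that obeys the rules for
-- q-integers and vanishes only at 0.  The inverse is a total operation, with
-- an arbitrary value at zero; it is not required to respect ≈, so that
-- inverses are only ever multiplied away.
record QField c ℓ : Set (Level.suc (c Level.⊔ ℓ)) where
  field
    ring : CommutativeRing c ℓ
  open CommutativeRing ring hiding (ring; zero)
  open Exp semiring using (_^_)
  infix 8 _⁻¹
  field
    q          : Carrier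
    [_]        : ℕ → Carrier
    _⁻¹        : Carrier → Carrier
    [0]≈0      : [ 0 ] ≈ 0#
    [+]        : ∀ a b → [ a ℕ.+ b ] ≈ [ a ] + q ^ a * [ b ]
    [suc]≉0    : ∀ a → ¬ ([ suc a ] ≈ 0#)
    ⁻¹-inverse : ∀ x → ¬ (x ≈ 0#) → x * x ⁻¹ ≈ 1#

module QIntegers {c ℓ} (F : CommutativeRing c ℓ) where
  open CommutativeRing F hiding (zero)
  open Exp semiring using (_^_; ^-homo-*)
  open RingProperties ring using (x[y-z]≈xy-xz; x∙y⁻¹≈ε⇒x≈y)
  open SetoidReasoning setoid

  1-xy : ∀ x y → 1# - x * y ≈ (1# - x) + x * (1# - y)
  1-xy x y = sym (begin
    (1# - x) + x * (1# - y)        ≈⟨ +-congˡ (trans (x[y-z]≈xy-xz x 1# y) (+-congʳ (*-identityʳ x))) ⟩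
    (1# - x) + (x - x * y)         ≈⟨ +-assoc _ _ _ ⟩
    1# + (- x + (x - x * y))       ≈⟨ +-congˡ (trans (sym (+-assoc _ _ _))
                                        (trans (+-congʳ (-‿inverseˡ x)) (+-identityˡ _))) ⟩
    1# - x * y                     ∎)

  -- The q-integers [a] = (1 - qᵃ)/(1 - q) for an element q of a field that is
  -- not a root of unity.
  module _ (q : Carrier) (_⁻¹ : Carrier → Carrier)
           (inverse : ∀ x → ¬ (x ≈ 0#) → x * (x ⁻¹) ≈ 1#)
           (q^suc≉1 : ∀ a → ¬ (q ^ suc a ≈ 1#)) where

    private
      1-q^suc≉0 : ∀ a → ¬ (1# - q ^ suc a ≈ 0#)
      1-q^suc≉0 a e = q^suc≉1 a (sym (x∙y⁻¹≈ε⇒x≈y 1# (q ^ suc a) e))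

      1-q≉0 : ¬ (1# - q ≈ 0#)
      1-q≉0 e = 1-q^suc≉0 0 (trans (+-congˡ (-‿cong (*-identityʳ q))) e)

      i : Carrier
      i = (1# - q) ⁻¹

    qfield : QField c ℓ
    qfield = record
      { ring = F ; q = q ; [_] = λ a → (1# - q ^ a) * i ; _⁻¹ = _⁻¹
      ; [0]≈0 = trans (*-congʳ (-‿inverseʳ 1#)) (zeroˡ i)
      ; [+] = λ a b → begin
          (1# - q ^ (a ℕ.+ b)) * i
            ≈⟨ *-congʳ (trans (+-congˡ (-‿cong (^-homo-* q a b))) (1-xy (q ^ a) (q ^ b))) ⟩
          ((1# - q ^ a) + q ^ a * (1# - q ^ b)) * i
            ≈⟨ trans (distribʳ _ _ _) (+-congˡ (*-assoc _ _ _)) ⟩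
          (1# - q ^ a) * i + q ^ a * ((1# - q ^ b) * i) ∎
      ; [suc]≉0 = λ a e → 1-q^suc≉0 a (begin
          1# - q ^ suc a                      ≈⟨ *-identityʳ _ ⟨
          (1# - q ^ suc a) * 1#               ≈⟨ *-congˡ (trans (*-comm i _) (inverse _ 1-q≉0)) ⟨
          (1# - q ^ suc a) * (i * (1# - q))   ≈⟨ *-assoc _ _ _ ⟨
          (1# - q ^ suc a) * i * (1# - q)     ≈⟨ *-congʳ e ⟩
          0# * (1# - q)                       ≈⟨ zeroˡ _ ⟩
          0#                                  ∎)
      ; ⁻¹-inverse = inverse
      }

module QCalculus {c ℓ} (𝔽 : QField c ℓ) where
  open QField 𝔽
  open CommutativeRing ring hiding (ring; zero)
  open Exp semiring using (_^_; ^-homo-*; ^-congʳ)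
  open RingProperties (CommutativeRing.ring ring) using (-‿distribˡ-*; -‿distribʳ-*)
  open BigOperators ring
  open BigOperatorProperties ring
  open SetoidReasoning setoid
  open Solver commutativeSemiring using (solve; _:=_; _:*_; _:+_; con)

  *-cancelˡ : ∀ {x y z} → ¬ (x ≈ 0#) → x * y ≈ x * z → y ≈ z
  *-cancelˡ {x} {y} {z} x≉0 e = begin
    y                ≈⟨ *-identityˡ y ⟨
    1# * y           ≈⟨ *-congʳ (⁻¹-inverse x x≉0) ⟨
    x * x ⁻¹ * y     ≈⟨ solve 3 (λ x i y → x :* i :* y := i :* (x :* y)) refl x (x ⁻¹) y ⟩
    x ⁻¹ * (x * y)   ≈⟨ *-congˡ e ⟩
    x ⁻¹ * (x * z)   ≈⟨ solve 3 (λ x i y → x :* i :* y := i :* (x :* y)) refl x (x ⁻¹) z ⟨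
    x * x ⁻¹ * z     ≈⟨ *-congʳ (⁻¹-inverse x x≉0) ⟩
    1# * z           ≈⟨ *-identityˡ z ⟩
    z                ∎

  *-nonzero : ∀ {x y} → ¬ (x ≈ 0#) → ¬ (y ≈ 0#) → ¬ (x * y ≈ 0#)
  *-nonzero {x} x≉0 y≉0 e = y≉0 (*-cancelˡ x≉0 (trans e (sym (zeroʳ x))))

  1≉0 : ¬ (1# ≈ 0#)
  1≉0 e = [suc]≉0 0 (trans (sym (*-identityˡ _)) (trans (*-congʳ e) (zeroˡ _)))

  -- The falling factorial [a][a-1]⋯[a-k+1].
  [_]↓_ : ℕ → ℕ → Carrier
  [ a ]↓ k = ∏[ i ∈ upTo k ] [ a ∸ i ]

  [_]! : ℕ → Carrier
  [ a ]! = [ a ]↓ a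

  [_choose_] : ℕ → ℕ → Carrier
  [ a choose b ] = ([ a ]↓ b) * [ b ]! ⁻¹

  ↓-suc : ∀ a k → [ suc a ]↓ suc k ≈ [ suc a ] * [ a ]↓ k
  ↓-suc a k = *-congˡ (∏-applyUpTo-cong suc (λ i → i) _ _ k (λ _ → refl))

  ↓-last : ∀ a k → [ a ]↓ suc k ≈ [ a ]↓ k * [ a ∸ k ]
  ↓-last a k = ∏-snoc (λ i → i) k _

  ↓-zero : ∀ {a k} → a < k → [ a ]↓ k ≈ 0#
  ↓-zero {zero}  {suc k} a<k       = trans (*-congʳ [0]≈0) (zeroˡ _)
  ↓-zero {suc a} {suc k} (s≤s a<k) = trans (↓-suc a k) (trans (*-congˡ (↓-zero a<k)) (zeroʳ _))

  ↓-*-! : ∀ a k → [ k ℕ.+ a ]↓ k * [ a ]! ≈ [ k ℕ.+ a ]!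
  ↓-*-! a zero    = *-identityˡ _
  ↓-*-! a (suc k) = begin
    [ suc (k ℕ.+ a) ]↓ suc k * [ a ]!                ≈⟨ *-congʳ (↓-suc (k ℕ.+ a) k) ⟩
    [ suc (k ℕ.+ a) ] * [ k ℕ.+ a ]↓ k * [ a ]!      ≈⟨ *-assoc _ _ _ ⟩
    [ suc (k ℕ.+ a) ] * ([ k ℕ.+ a ]↓ k * [ a ]!)    ≈⟨ *-congˡ (↓-*-! a k) ⟩
    [ suc (k ℕ.+ a) ] * [ k ℕ.+ a ]!                 ≈⟨ ↓-suc (k ℕ.+ a) (k ℕ.+ a) ⟨
    [ suc (k ℕ.+ a) ]!                               ∎

  !≉0 : ∀ a → ¬ ([ a ]! ≈ 0#)
  !≉0 zero    = 1≉0
  !≉0 (suc a) e = *-nonzero ([suc]≉0 a) (!≉0 a) (trans (sym (↓-suc a a)) e)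

  !-inverse : ∀ a → [ a ]! * [ a ]! ⁻¹ ≈ 1#
  !-inverse a = ⁻¹-inverse _ (!≉0 a)

  choose-*-! : ∀ a b → [ b ℕ.+ a choose b ] * ([ b ]! * [ a ]!) ≈ [ b ℕ.+ a ]!
  choose-*-! a b = begin
    [ b ℕ.+ a ]↓ b * [ b ]! ⁻¹ * ([ b ]! * [ a ]!)
      ≈⟨ solve 4 (λ f i b a → f :* i :* (b :* a) := (f :* a) :* (b :* i)) refl _ _ _ _ ⟩
    [ b ℕ.+ a ]↓ b * [ a ]! * ([ b ]! * [ b ]! ⁻¹)   ≈⟨ *-cong (↓-*-! a b) (!-inverse b) ⟩
    [ b ℕ.+ a ]! * 1#                                ≈⟨ *-identityʳ _ ⟩
    [ b ℕ.+ a ]!                                     ∎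

  -- Coefficients of the q-Pochhammer symbol

  -- The coefficient of xʲ in (x;q)ₛ, that is (-1)ʲ q^(j choose 2) [s choose j],
  -- by the recursion (x;q)ₛ₊₁ = (x;q)ₛ (1 - qˢ x).  Working with these signed
  -- coefficients replaces the q-Pascal rule by this recursion.
  pochhammer : ℕ → ℕ → Carrier
  pochhammer s       zero    = 1#
  pochhammer zero    (suc j) = 0#
  pochhammer (suc s) (suc j) = pochhammer s (suc j) + (- (q ^ s)) * pochhammer s j

  pochhammer-zero : ∀ {s j} → s < j → pochhammer s j ≈ 0#
  pochhammer-zero {zero}  {suc j} _         = refl
  pochhammer-zero {suc s} {suc j} (s≤s s<j) = begin
    pochhammer s (suc j) + - (q ^ s) * pochhammer s j
      ≈⟨ +-cong (pochhammer-zero (ℕₚ.m<n⇒m<1+n s<j)) (*-congˡ (pochhammer-zero s<j)) ⟩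
    0# + - (q ^ s) * 0#   ≈⟨ +-identityˡ _ ⟩
    - (q ^ s) * 0#        ≈⟨ zeroʳ _ ⟩
    0#                    ∎

  -- (-1)ᵗ q^(t choose 2), the leading coefficient of (x;q)ₜ.
  sign : ℕ → Carrier
  sign zero    = 1#
  sign (suc t) = - (q ^ t) * sign t

  -q^-+ : ∀ m n → - (q ^ (m ℕ.+ n)) ≈ - (q ^ m) * q ^ n
  -q^-+ m n = trans (-‿cong (^-homo-* q m n)) (-‿distribˡ-* _ _)

  sign-+ : ∀ r t → sign (r ℕ.+ t) ≈ sign r * sign t * q ^ (r ℕ.* t)
  sign-+ r zero rewrite ℕₚ.+-identityʳ r | ℕₚ.*-zeroʳ r =
    sym (trans (*-identityʳ _) (*-identityʳ _))
  sign-+ r (suc t) = begin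
    sign (r ℕ.+ suc t)                                      ≡⟨ ≡.cong sign (ℕₚ.+-suc r t) ⟩
    - (q ^ (r ℕ.+ t)) * sign (r ℕ.+ t)
      ≈⟨ *-cong (trans (reflexive (≡.cong (λ n → - (q ^ n)) (ℕₚ.+-comm r t))) (-q^-+ t r)) (sign-+ r t) ⟩
    - (q ^ t) * q ^ r * (sign r * sign t * q ^ (r ℕ.* t))
      ≈⟨ solve 5 (λ n p a b c → n :* p :* (a :* b :* c) := a :* (n :* b) :* (p :* c)) refl _ _ _ _ _ ⟩
    sign r * (- (q ^ t) * sign t) * (q ^ r * q ^ (r ℕ.* t))  ≈⟨ *-congˡ (^-homo-* q r (r ℕ.* t)) ⟨
    sign r * sign (suc t) * q ^ (r ℕ.+ r ℕ.* t)
      ≡⟨ ≡.cong (λ n → sign r * sign (suc t) * q ^ n) (ℕₚ.*-suc r t) ⟨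
    sign r * sign (suc t) * q ^ (r ℕ.* suc t)                ∎

  -- The q-binomial theorem, with denominators cleared.
  pochhammer-*-! : ∀ t u → pochhammer (t ℕ.+ u) t * ([ t ]! * [ u ]!) ≈ sign t * [ t ℕ.+ u ]!
  pochhammer-*-! zero    u       = *-congˡ (*-identityˡ _)
  pochhammer-*-! (suc t) zero    = begin
    (pochhammer (t ℕ.+ 0) (suc t) + - (q ^ (t ℕ.+ 0)) * pochhammer (t ℕ.+ 0) t) * ([ suc t ]! * 1#)
      ≈⟨ *-cong (trans (+-cong (pochhammer-zero (ℕ.s≤s (ℕₚ.≤-reflexive (ℕₚ.+-identityʳ t))))
           (*-congʳ (reflexive (≡.cong (λ n → - (q ^ n)) (ℕₚ.+-identityʳ t))))) (+-identityˡ _))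
           (*-congʳ (↓-suc t t)) ⟩
    - (q ^ t) * pochhammer (t ℕ.+ 0) t * ([ suc t ] * [ t ]! * 1#)
      ≈⟨ solve 5 (λ n p a b o → n :* p :* (a :* b :* o) := n :* (p :* (b :* o)) :* a) refl _ _ _ _ _ ⟩
    - (q ^ t) * (pochhammer (t ℕ.+ 0) t * ([ t ]! * 1#)) * [ suc t ]
      ≈⟨ *-congʳ (*-congˡ (pochhammer-*-! t zero)) ⟩
    - (q ^ t) * (sign t * [ t ℕ.+ 0 ]!) * [ suc t ]
      ≈⟨ solve 4 (λ n p a b → n :* (p :* a) :* b := n :* p :* (b :* a)) refl _ _ _ _ ⟩
    sign (suc t) * ([ suc t ] * [ t ℕ.+ 0 ]!)
      ≡⟨ ≡.cong (λ n → sign (suc t) * ([ suc n ] * [ t ℕ.+ 0 ]!)) (ℕₚ.+-identityʳ t) ⟨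
    sign (suc t) * ([ suc (t ℕ.+ 0) ] * [ t ℕ.+ 0 ]!)
      ≈⟨ *-congˡ (↓-suc (t ℕ.+ 0) (t ℕ.+ 0)) ⟨
    sign (suc t) * [ suc t ℕ.+ 0 ]! ∎
  pochhammer-*-! (suc t) (suc u) = begin
    (pochhammer (t ℕ.+ suc u) (suc t) + - (q ^ (t ℕ.+ suc u)) * pochhammer (t ℕ.+ suc u) t)
      * ([ suc t ]! * [ suc u ]!)
      ≈⟨ distribʳ _ _ _ ⟩
    pochhammer (t ℕ.+ suc u) (suc t) * ([ suc t ]! * [ suc u ]!)
      + - (q ^ (t ℕ.+ suc u)) * pochhammer (t ℕ.+ suc u) t * ([ suc t ]! * [ suc u ]!)
      ≈⟨ +-cong
           (begin
             pochhammer (t ℕ.+ suc u) (suc t) * ([ suc t ]! * [ suc u ]!)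
               ≈⟨ *-cong (reflexive (≡.cong (λ n → pochhammer n (suc t)) (ℕₚ.+-suc t u))) (*-congˡ (↓-suc u u)) ⟩
             pochhammer (suc t ℕ.+ u) (suc t) * ([ suc t ]! * ([ suc u ] * [ u ]!))
               ≈⟨ solve 4 (λ p a b c → p :* (a :* (b :* c)) := p :* (a :* c) :* b) refl _ _ _ _ ⟩
             pochhammer (suc t ℕ.+ u) (suc t) * ([ suc t ]! * [ u ]!) * [ suc u ]
               ≈⟨ *-congʳ (pochhammer-*-! (suc t) u) ⟩
             - (q ^ t) * sign t * [ suc t ℕ.+ u ]! * [ suc u ]
               ≡⟨ ≡.cong (λ n → - (q ^ t) * sign t * [ n ]! * [ suc u ]) (ℕₚ.+-suc t u) ⟨
             - (q ^ t) * sign t * [ t ℕ.+ suc u ]! * [ suc u ] ∎)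
           (begin
             - (q ^ (t ℕ.+ suc u)) * pochhammer (t ℕ.+ suc u) t * ([ suc t ]! * [ suc u ]!)
               ≈⟨ *-cong (*-congʳ (-q^-+ t (suc u))) (*-congʳ (↓-suc t t)) ⟩
             - (q ^ t) * q ^ suc u * pochhammer (t ℕ.+ suc u) t * ([ suc t ] * [ t ]! * [ suc u ]!)
               ≈⟨ solve 6 (λ n o p a b c → n :* o :* p :* (a :* b :* c) :=
                    n :* (p :* (b :* c)) :* (o :* a)) refl _ _ _ _ _ _ ⟩
             - (q ^ t) * (pochhammer (t ℕ.+ suc u) t * ([ t ]! * [ suc u ]!)) * (q ^ suc u * [ suc t ])
               ≈⟨ *-congʳ (*-congˡ (pochhammer-*-! t (suc u))) ⟩
             - (q ^ t) * (sign t * [ t ℕ.+ suc u ]!) * (q ^ suc u * [ suc t ]) ∎) ⟩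
    - (q ^ t) * sign t * [ t ℕ.+ suc u ]! * [ suc u ]
      + - (q ^ t) * (sign t * [ t ℕ.+ suc u ]!) * (q ^ suc u * [ suc t ])
      ≈⟨ solve 5 (λ n s f a b → n :* s :* f :* a :+ n :* (s :* f) :* b :=
           n :* s :* ((a :+ b) :* f)) refl _ _ _ _ _ ⟩
    sign (suc t) * (([ suc u ] + q ^ suc u * [ suc t ]) * [ t ℕ.+ suc u ]!)
      ≈⟨ *-congˡ (*-congʳ ([+] (suc u) (suc t))) ⟨
    sign (suc t) * ([ suc u ℕ.+ suc t ] * [ t ℕ.+ suc u ]!)
      ≡⟨ ≡.cong (λ n → sign (suc t) * ([ n ] * [ t ℕ.+ suc u ]!)) (ℕₚ.+-comm (suc u) (suc t)) ⟩
    sign (suc t) * ([ suc (t ℕ.+ suc u) ] * [ t ℕ.+ suc u ]!)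
      ≈⟨ *-congˡ (↓-suc (t ℕ.+ suc u) (t ℕ.+ suc u)) ⟨
    sign (suc t) * [ suc t ℕ.+ suc u ]! ∎

  -- The q-analogue of [i choose j][j choose r] = [i choose r][i-r choose j-r],
  -- with i = r + s and j = r + t; the power of q comes from sign-+.
  pochhammer-trinomial : ∀ r s t →
    pochhammer (r ℕ.+ s) (r ℕ.+ t) * [ r ℕ.+ t choose r ] ≈
    q ^ (r ℕ.* t) * pochhammer (r ℕ.+ s) r * pochhammer s t
  pochhammer-trinomial r s t with ℕₚ.≤-<-connex t s
  ... | inj₂ s<t = begin
    pochhammer (r ℕ.+ s) (r ℕ.+ t) * _                       ≈⟨ *-congʳ (pochhammer-zero (ℕₚ.+-monoʳ-< r s<t)) ⟩
    0# * _                                                   ≈⟨ zeroˡ _ ⟩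
    0#                                                       ≈⟨ zeroʳ _ ⟨
    q ^ (r ℕ.* t) * pochhammer (r ℕ.+ s) r * 0#              ≈⟨ *-congˡ (pochhammer-zero s<t) ⟨
    q ^ (r ℕ.* t) * pochhammer (r ℕ.+ s) r * pochhammer s t  ∎
  ... | inj₁ t≤s with ℕₚ.m≤n⇒∃[o]m+o≡n t≤s
  ... | u , ≡.refl = *-cancelˡ M≉0 (begin
    M * (pochhammer (r ℕ.+ (t ℕ.+ u)) (r ℕ.+ t) * [ r ℕ.+ t choose r ])
      ≈⟨ solve 7 (λ rt u t r tu p c → (rt :* u) :* ((r :* t) :* tu) :* (p :* c) :=
           p :* (rt :* u) :* (c :* (r :* t)) :* tu) refl
           [ r ℕ.+ t ]! [ u ]! [ t ]! [ r ]! [ t ℕ.+ u ]! _ _ ⟩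
    pochhammer (r ℕ.+ (t ℕ.+ u)) (r ℕ.+ t) * ([ r ℕ.+ t ]! * [ u ]!)
      * ([ r ℕ.+ t choose r ] * ([ r ]! * [ t ]!)) * [ t ℕ.+ u ]!
      ≡⟨ ≡.cong (λ n → pochhammer n (r ℕ.+ t) * ([ r ℕ.+ t ]! * [ u ]!)
      * ([ r ℕ.+ t choose r ] * ([ r ]! * [ t ]!)) * [ t ℕ.+ u ]!) (ℕₚ.+-assoc r t u) ⟨
    pochhammer (r ℕ.+ t ℕ.+ u) (r ℕ.+ t) * ([ r ℕ.+ t ]! * [ u ]!)
      * ([ r ℕ.+ t choose r ] * ([ r ]! * [ t ]!)) * [ t ℕ.+ u ]!
      ≈⟨ *-congʳ (*-cong (pochhammer-*-! (r ℕ.+ t) u) (choose-*-! t r)) ⟩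
    sign (r ℕ.+ t) * [ r ℕ.+ t ℕ.+ u ]! * [ r ℕ.+ t ]! * [ t ℕ.+ u ]!
      ≈⟨ *-congʳ (*-congʳ (*-cong (sign-+ r t) (reflexive (≡.cong [_]! (ℕₚ.+-assoc r t u))))) ⟩
    sign r * sign t * q ^ (r ℕ.* t) * [ r ℕ.+ (t ℕ.+ u) ]! * [ r ℕ.+ t ]! * [ t ℕ.+ u ]!
      ≈⟨ solve 6 (λ wr wt p n rt tu → wr :* wt :* p :* n :* rt :* tu :=
           p :* rt :* (wr :* n) :* (wt :* tu)) refl _ _ _ _ _ _ ⟩
    q ^ (r ℕ.* t) * [ r ℕ.+ t ]! * (sign r * [ r ℕ.+ (t ℕ.+ u) ]!) * (sign t * [ t ℕ.+ u ]!)
      ≈⟨ *-cong (*-congˡ (pochhammer-*-! r (t ℕ.+ u))) (pochhammer-*-! t u) ⟨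
    q ^ (r ℕ.* t) * [ r ℕ.+ t ]! * (pochhammer (r ℕ.+ (t ℕ.+ u)) r * ([ r ]! * [ t ℕ.+ u ]!))
      * (pochhammer (t ℕ.+ u) t * ([ t ]! * [ u ]!))
      ≈⟨ solve 8 (λ rt u t r tu p c d →
           p :* rt :* (c :* (r :* tu)) :* (d :* (t :* u)) :=
           (rt :* u) :* ((r :* t) :* tu) :* (p :* c :* d)) refl
           [ r ℕ.+ t ]! [ u ]! [ t ]! [ r ]! [ t ℕ.+ u ]! _ _ _ ⟩
    M * (q ^ (r ℕ.* t) * pochhammer (r ℕ.+ (t ℕ.+ u)) r * pochhammer (t ℕ.+ u) t) ∎)
    where
    M = ([ r ℕ.+ t ]! * [ u ]!) * (([ r ]! * [ t ]!) * [ t ℕ.+ u ]!)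
    M≉0 : ¬ (M ≈ 0#)
    M≉0 = *-nonzero (*-nonzero (!≉0 (r ℕ.+ t)) (!≉0 u)) (*-nonzero (*-nonzero (!≉0 r) (!≉0 t)) (!≉0 (t ℕ.+ u)))

  -- q-differences of falling factorials

  -- The operator obtained from (x;q)ₛ by substituting for x the shift
  -- f ↦ f ∘ suc, applied to f and evaluated at 0.
  Δ : ℕ → (ℕ → Carrier) → Carrier
  Δ zero    f = f 0
  Δ (suc s) f = Δ s f + - (q ^ s) * Δ s (f ∘ suc)

  Δ-zero : ∀ s {f} → (∀ t → f t ≈ 0#) → Δ s f ≈ 0#
  Δ-zero zero    e = e 0
  Δ-zero (suc s) e = trans (+-cong (Δ-zero s e) (trans (*-congˡ (Δ-zero s (e ∘ suc))) (zeroʳ _))) (+-identityˡ 0#)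

  ∑-pochhammer : ∀ s B f → s ≤ B → (∑[ t ∈ upTo (suc B) ] pochhammer s t * f t) ≈ Δ s f
  ∑-pochhammer zero    B       f _ = begin
    1# * f 0 + ∑ (applyUpTo suc B) (λ t → pochhammer 0 t * f t)
      ≈⟨ +-cong (*-identityˡ _) (trans
           (∑-applyUpTo-cong suc (λ i → i) _ (λ _ → 0#) B (λ i _ → zeroˡ _))
           (∑-zero (upTo B) _ (λ _ → refl))) ⟩
    f 0 + 0#   ≈⟨ +-identityʳ _ ⟩
    f 0        ∎
  ∑-pochhammer (suc s) (suc B) f (s≤s s≤B) = begin
    1# * f 0 + ∑ (applyUpTo suc (suc B)) (λ t → pochhammer (suc s) t * f t)
      ≈⟨ +-congˡ (∑-applyUpTo-cong suc (λ i → i) _ _ (suc B) (λ i _ →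
           trans (distribʳ _ _ _) (+-congˡ (*-assoc _ _ _)))) ⟩
    1# * f 0 + (∑[ t ∈ upTo (suc B) ]
      (pochhammer s (suc t) * f (suc t) + - (q ^ s) * (pochhammer s t * f (suc t))))
      ≈⟨ +-congˡ (trans (∑-+ (upTo (suc B)) _ _) (+-congˡ (sym (∑-*ˡ (upTo (suc B)) _ _)))) ⟩
    1# * f 0 + ((∑[ t ∈ upTo (suc B) ] pochhammer s (suc t) * f (suc t))
      + - (q ^ s) * (∑[ t ∈ upTo (suc B) ] pochhammer s t * f (suc t)))
      ≈⟨ +-assoc _ _ _ ⟨
    1# * f 0 + (∑[ t ∈ upTo (suc B) ] pochhammer s (suc t) * f (suc t))
      + - (q ^ s) * (∑[ t ∈ upTo (suc B) ] pochhammer s t * f (suc t))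
      ≈⟨ +-cong (+-congˡ (∑-applyUpTo-cong (λ i → i) suc _ _ (suc B) (λ i _ → refl)))
           (*-congˡ (∑-pochhammer s B (f ∘ suc) s≤B)) ⟩
    (∑[ t ∈ upTo (suc (suc B)) ] pochhammer s t * f t) + - (q ^ s) * Δ s (f ∘ suc)
      ≈⟨ +-congʳ (∑-pochhammer s (suc B) f (ℕₚ.m≤n⇒m≤1+n s≤B)) ⟩
    Δ (suc s) f ∎

  ↓-difference : ∀ a e → [ suc a ℕ.+ e ]↓ suc a + - ([ a ℕ.+ e ]↓ suc a) ≈ q ^ e * [ suc a ] * [ a ℕ.+ e ]↓ a
  ↓-difference a e = begin
    [ suc (a ℕ.+ e) ]↓ suc a + - ([ a ℕ.+ e ]↓ suc a)
      ≈⟨ +-cong (trans (↓-suc _ a) (*-congʳ (trans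
           (reflexive (≡.cong [_] (ℕₚ.+-comm (suc a) e)))
           ([+] e (suc a)))))
           (-‿cong (trans (↓-last (a ℕ.+ e) a) (trans
             (*-congˡ (reflexive (≡.cong [_] (ℕₚ.m+n∸m≡n a e)))) (*-comm _ _)))) ⟩
    ([ e ] + q ^ e * [ suc a ]) * [ a ℕ.+ e ]↓ a + - ([ e ] * [ a ℕ.+ e ]↓ a)
      ≈⟨ solve 4 (λ x y z w → (x :+ y) :* z :+ w := (x :* z :+ w) :+ y :* z) refl _ _ _ _ ⟩
    ([ e ] * [ a ℕ.+ e ]↓ a + - ([ e ] * [ a ℕ.+ e ]↓ a)) + q ^ e * [ suc a ] * [ a ℕ.+ e ]↓ a
      ≈⟨ +-congʳ (-‿inverseʳ _) ⟩
    0# + q ^ e * [ suc a ] * [ a ℕ.+ e ]↓ a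
      ≈⟨ +-identityˡ _ ⟩
    q ^ e * [ suc a ] * [ a ℕ.+ e ]↓ a ∎

  -- The s-th q-difference of the falling factorials [x-t]ₐ at x = a + e.
  -- In the inductive step the shifted sequence starts at a + e - 1, so for
  -- e = 0 it consists of zeros only; shifted covers both cases at once.
  Δ-↓ : ∀ s b e {a x} → a ≡ s ℕ.+ b → x ≡ a ℕ.+ e →
    Δ s (λ t → [ x ∸ t ]↓ a) ≈ [ a ]↓ s * ([ b ℕ.+ e ]↓ b * q ^ (e ℕ.* s))
  Δ-↓ zero b e ≡.refl ≡.refl rewrite ℕₚ.*-zeroʳ e =
    sym (trans (*-identityˡ _) (*-identityʳ _))
  Δ-↓ (suc s) b e ≡.refl ≡.refl = begin
    Δ s (λ t → [ suc y ∸ t ]↓ a) + - (q ^ s) * Δ s (λ t → [ y ∸ t ]↓ a)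
      ≈⟨ +-cong (Δ-↓ s (suc b) e (≡.sym (ℕₚ.+-suc s b)) ≡.refl)
           (trans (sym (-‿distribˡ-* _ _)) (-‿cong (shifted e))) ⟩
    [ a ]↓ s * ([ suc b ℕ.+ e ]↓ suc b * q ^ (e ℕ.* s)) + - ([ a ]↓ s * ([ b ℕ.+ e ]↓ suc b * q ^ (e ℕ.* s)))
      ≈⟨ +-congˡ (trans (-‿distribʳ-* _ _) (*-congˡ (-‿distribˡ-* _ _))) ⟩
    [ a ]↓ s * ([ suc b ℕ.+ e ]↓ suc b * q ^ (e ℕ.* s)) + [ a ]↓ s * (- ([ b ℕ.+ e ]↓ suc b) * q ^ (e ℕ.* s))
      ≈⟨ solve 4 (λ f x y p → f :* (x :* p) :+ f :* (y :* p) := f :* ((x :+ y) :* p)) refl _ _ _ _ ⟩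
    [ a ]↓ s * (([ suc b ℕ.+ e ]↓ suc b + - ([ b ℕ.+ e ]↓ suc b)) * q ^ (e ℕ.* s))
      ≈⟨ *-congˡ (*-congʳ (↓-difference b e)) ⟩
    [ a ]↓ s * (q ^ e * [ suc b ] * [ b ℕ.+ e ]↓ b * q ^ (e ℕ.* s))
      ≈⟨ solve 5 (λ f p x y r → f :* (p :* x :* y :* r) := (f :* x) :* (y :* (p :* r))) refl _ _ _ _ _ ⟩
    ([ a ]↓ s * [ suc b ]) * ([ b ℕ.+ e ]↓ b * (q ^ e * q ^ (e ℕ.* s)))
      ≈⟨ *-cong
           (trans (↓-last a s) (*-congˡ (reflexive (≡.cong [_]
             (≡.trans (≡.cong (_∸ s) (≡.sym (ℕₚ.+-suc s b))) (ℕₚ.m+n∸m≡n s (suc b)))))))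
           (*-congˡ (trans (^-congʳ q (ℕₚ.*-suc e s)) (^-homo-* q e (e ℕ.* s)))) ⟨
    [ a ]↓ suc s * ([ b ℕ.+ e ]↓ b * q ^ (e ℕ.* suc s)) ∎
    where
    a = suc s ℕ.+ b
    y = s ℕ.+ b ℕ.+ e
    shifted : ∀ e → q ^ s * Δ s (λ t → [ (s ℕ.+ b ℕ.+ e) ∸ t ]↓ a) ≈
                    [ a ]↓ s * ([ b ℕ.+ e ]↓ suc b * q ^ (e ℕ.* s))
    shifted zero = begin
      q ^ s * Δ s (λ t → [ (s ℕ.+ b ℕ.+ 0) ∸ t ]↓ a)
        ≈⟨ *-congˡ (Δ-zero s (λ t → ↓-zero (s≤s (ℕₚ.≤-trans (ℕₚ.m∸n≤m _ t) (ℕₚ.≤-reflexive (ℕₚ.+-identityʳ _)))))) ⟩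
      q ^ s * 0#                                     ≈⟨ zeroʳ _ ⟩
      0#                                             ≈⟨ zeroʳ _ ⟨
      [ a ]↓ s * 0#                                  ≈⟨ *-congˡ (zeroˡ _) ⟨
      [ a ]↓ s * (0# * q ^ (0 ℕ.* s))
        ≈⟨ *-congˡ (*-congʳ (↓-zero (s≤s (ℕₚ.≤-reflexive (ℕₚ.+-identityʳ b))))) ⟨
      [ a ]↓ s * ([ b ℕ.+ 0 ]↓ suc b * q ^ (0 ℕ.* s)) ∎
    shifted (suc e) = begin
      q ^ s * Δ s (λ t → [ (s ℕ.+ b ℕ.+ suc e) ∸ t ]↓ a)
        ≈⟨ *-congˡ (Δ-↓ s (suc b) e (≡.sym (ℕₚ.+-suc s b)) (ℕₚ.+-suc (s ℕ.+ b) e)) ⟩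
      q ^ s * ([ a ]↓ s * ([ suc b ℕ.+ e ]↓ suc b * q ^ (e ℕ.* s)))
        ≈⟨ solve 4 (λ p f x r → p :* (f :* (x :* r)) := f :* (x :* (p :* r))) refl _ _ _ _ ⟩
      [ a ]↓ s * ([ suc b ℕ.+ e ]↓ suc b * (q ^ s * q ^ (e ℕ.* s)))
        ≈⟨ *-congˡ (*-cong (reflexive (≡.cong ([_]↓ suc b) (ℕₚ.+-suc b e))) (^-homo-* q s (e ℕ.* s))) ⟨
      [ a ]↓ s * ([ b ℕ.+ suc e ]↓ suc b * q ^ (suc e ℕ.* s)) ∎

  -- The coefficients of a single rook number

  -- The first identity for the coefficient of R(k), with a = m - k = b + d,
  -- b = n - k and d = m - n.
  top-term : ∀ b d →
    [ b ℕ.+ d choose b ] * [ b ℕ.+ d ℕ.+ b ]! ≈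
    [ d ]! ⁻¹ * [ b ℕ.+ d ]! * [ b ℕ.+ d ℕ.+ b ]↓ (b ℕ.+ d)
  top-term b d = *-cancelˡ (*-nonzero (!≉0 b) (!≉0 d)) (begin
    [ b ]! * [ d ]! * ([ a choose b ] * [ a ℕ.+ b ]!)
      ≈⟨ solve 4 (λ b d c n → b :* d :* (c :* n) := c :* (b :* d) :* n) refl _ _ _ _ ⟩
    [ a choose b ] * ([ b ]! * [ d ]!) * [ a ℕ.+ b ]!
      ≈⟨ *-cong (choose-*-! d b) (sym (↓-*-! b a)) ⟩
    [ a ]! * ([ a ℕ.+ b ]↓ a * [ b ]!)
      ≈⟨ *-identityˡ _ ⟨
    1# * ([ a ]! * ([ a ℕ.+ b ]↓ a * [ b ]!))
      ≈⟨ *-congʳ (!-inverse d) ⟨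
    [ d ]! * [ d ]! ⁻¹ * ([ a ]! * ([ a ℕ.+ b ]↓ a * [ b ]!))
      ≈⟨ solve 5 (λ d i a f b → d :* i :* (a :* (f :* b)) := b :* d :* (i :* a :* f)) refl _ _ _ _ _ ⟩
    [ b ]! * [ d ]! * ([ d ]! ⁻¹ * [ a ]! * [ a ℕ.+ b ]↓ a) ∎)
    where a = b ℕ.+ d

  -- In alternating-sum and lower-term, e = n - r - 1, a = m - r = e + 1 + d and
  -- d = m - n.
  alternating-sum : ∀ e d s → s ≤ suc e → let a = suc e ℕ.+ d in
    [ a choose suc e ] * [ a ℕ.+ e ∸ s ]! * q ^ (e ℕ.* s) ≈
    [ d ]! ⁻¹ * [ a ∸ s ]! *
      ([ suc e ] ⁻¹ * (∑[ t ∈ upTo (suc (suc e)) ] pochhammer s t * [ a ℕ.+ e ∸ t ]↓ a))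
  alternating-sum e d s s≤b = *-cancelˡ (*-nonzero (!≉0 (suc e)) (!≉0 d)) (begin
    [ suc e ]! * [ d ]! * ([ a choose suc e ] * [ a ℕ.+ e ∸ s ]! * q ^ (e ℕ.* s))
      ≈⟨ solve 5 (λ b d c n p → b :* d :* (c :* n :* p) := c :* (b :* d) :* n :* p) refl _ _ _ _ _ ⟩
    [ a choose suc e ] * ([ suc e ]! * [ d ]!) * [ a ℕ.+ e ∸ s ]! * q ^ (e ℕ.* s)
      ≈⟨ *-congʳ (*-cong (choose-*-! d (suc e)) (trans (reflexive (≡.cong [_]! a+e∸s≡)) (sym (↓-*-! e (a ∸ s))))) ⟩
    [ a ]! * ([ (a ∸ s) ℕ.+ e ]↓ (a ∸ s) * [ e ]!) * q ^ (e ℕ.* s)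
      ≈⟨ *-congʳ (*-congʳ (trans (reflexive (≡.cong [_]! s+a∸s≡))
           (trans (sym (↓-*-! (a ∸ s) s)) (*-congʳ (reflexive (≡.cong ([_]↓ s) (≡.sym s+a∸s≡))))))) ⟩
    [ a ]↓ s * [ a ∸ s ]! * ([ (a ∸ s) ℕ.+ e ]↓ (a ∸ s) * [ e ]!) * q ^ (e ℕ.* s)
      ≈⟨ trans (*-congʳ (trans (*-cong (⁻¹-inverse _ ([suc]≉0 e)) (!-inverse d)) (*-identityˡ 1#))) (*-identityˡ _) ⟨
    ([ suc e ] * [ suc e ] ⁻¹) * ([ d ]! * [ d ]! ⁻¹)
      * ([ a ]↓ s * [ a ∸ s ]! * ([ (a ∸ s) ℕ.+ e ]↓ (a ∸ s) * [ e ]!) * q ^ (e ℕ.* s))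
      ≈⟨ solve 9 (λ b ib d id f g h k p →
           (b :* ib) :* (d :* id) :* (f :* g :* (h :* k) :* p) :=
           b :* k :* d :* (id :* g :* (ib :* (f :* (h :* p))))) refl _ _ _ _ _ _ _ _ _ ⟩
    [ suc e ] * [ e ]! * [ d ]! * ([ d ]! ⁻¹ * [ a ∸ s ]! * ([ suc e ] ⁻¹ *
      ([ a ]↓ s * ([ (a ∸ s) ℕ.+ e ]↓ (a ∸ s) * q ^ (e ℕ.* s)))))
      ≈⟨ *-cong (*-congʳ (↓-suc e e)) (*-congˡ (*-congˡ (trans
           (∑-pochhammer s (suc e) (λ t → [ a ℕ.+ e ∸ t ]↓ a) s≤b) (Δ-↓ s (a ∸ s) e s+a∸s≡ ≡.refl)))) ⟨
    [ suc e ]! * [ d ]! * ([ d ]! ⁻¹ * [ a ∸ s ]! * ([ suc e ] ⁻¹ *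
      (∑[ t ∈ upTo (suc (suc e)) ] pochhammer s t * [ a ℕ.+ e ∸ t ]↓ a))) ∎)
    where
    a = suc e ℕ.+ d
    s≤a : s ≤ a
    s≤a = ℕₚ.≤-trans s≤b (ℕₚ.m≤m+n (suc e) d)
    s+a∸s≡ : a ≡ s ℕ.+ (a ∸ s)
    s+a∸s≡ = ≡.sym (ℕₚ.m+[n∸m]≡n s≤a)
    a+e∸s≡ : a ℕ.+ e ∸ s ≡ (a ∸ s) ℕ.+ e
    a+e∸s≡ = ℕₚ.+-∸-comm e s≤a

  -- The second identity for the coefficient of R(r+s).  The sequence Q stands
  -- for the powers of q with exponent r (e - t), which may be negative.
  lower-term : ∀ e d r s (Q : ℕ → Carrier) → s ≤ suc e →
    (∀ t → Q t * q ^ (r ℕ.* t) ≈ q ^ (r ℕ.* e)) →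
    let a = suc e ℕ.+ d in
    [ a choose suc e ] * [ a ℕ.+ e ∸ s ]! * q ^ (e ℕ.* (r ℕ.+ s)) * pochhammer (r ℕ.+ s) r ≈
    [ d ]! ⁻¹ * [ a ∸ s ]! *
      (q ^ (r ℕ.* e) * [ a ℕ.+ e ]↓ (e ℕ.+ d) * pochhammer (r ℕ.+ s) r +
       ∑[ t ∈ applyUpTo suc (suc e) ]
         Q t * [ r ℕ.+ t choose r ] * ([ a ℕ.+ e ∸ t ]↓ a * [ suc e ] ⁻¹) * pochhammer (r ℕ.+ s) (r ℕ.+ t))
  lower-term e d r s Q s≤b Q-spec = begin
    [ a choose suc e ] * [ a ℕ.+ e ∸ s ]! * q ^ (e ℕ.* (r ℕ.+ s)) * P
      ≈⟨ *-congʳ (*-congˡ (trans (^-congʳ q (≡.trans (ℕₚ.*-distribˡ-+ e r s) (≡.cong (ℕ._+ e ℕ.* s) (ℕₚ.*-comm e r))))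
           (^-homo-* q (r ℕ.* e) (e ℕ.* s)))) ⟩
    [ a choose suc e ] * [ a ℕ.+ e ∸ s ]! * (q ^ (r ℕ.* e) * q ^ (e ℕ.* s)) * P
      ≈⟨ solve 5 (λ c n x y p → c :* n :* (x :* y) :* p := c :* n :* y :* (x :* p)) refl _ _ _ _ _ ⟩
    [ a choose suc e ] * [ a ℕ.+ e ∸ s ]! * q ^ (e ℕ.* s) * (q ^ (r ℕ.* e) * P)
      ≈⟨ *-congʳ (alternating-sum e d s s≤b) ⟩
    [ d ]! ⁻¹ * [ a ∸ s ]! * ([ suc e ] ⁻¹ * ∑ (upTo (suc (suc e))) f) * (q ^ (r ℕ.* e) * P)
      ≈⟨ solve 6 (λ i g b z x p → i :* g :* (b :* z) :* (x :* p) := i :* g :* (x :* p :* b :* z))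
           refl _ _ _ _ _ _ ⟩
    [ d ]! ⁻¹ * [ a ∸ s ]! * (coef * ∑ (upTo (suc (suc e))) f)
      ≈⟨ *-congˡ (trans (∑-*ˡ (upTo (suc (suc e))) coef f)
           (+-cong head (∑-applyUpTo-cong suc suc _ _ (suc e) (λ t _ → summand (suc t))))) ⟩
    [ d ]! ⁻¹ * [ a ∸ s ]! *
      (q ^ (r ℕ.* e) * [ a ℕ.+ e ]↓ (e ℕ.+ d) * P +
       ∑[ t ∈ applyUpTo suc (suc e) ]
         Q t * [ r ℕ.+ t choose r ] * ([ a ℕ.+ e ∸ t ]↓ a * [ suc e ] ⁻¹) * pochhammer (r ℕ.+ s) (r ℕ.+ t)) ∎
    where
    a = suc e ℕ.+ d
    P = pochhammer (r ℕ.+ s) r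
    coef = q ^ (r ℕ.* e) * P * [ suc e ] ⁻¹
    f : ℕ → Carrier
    f t = pochhammer s t * [ a ℕ.+ e ∸ t ]↓ a
    -- The term t = 0, since [a+e]ₐ = [a+e]ₐ₋₁ [e+1].
    head : coef * f 0 ≈ q ^ (r ℕ.* e) * [ a ℕ.+ e ]↓ (e ℕ.+ d) * P
    head = begin
      coef * (1# * [ a ℕ.+ e ]↓ suc (e ℕ.+ d))
        ≈⟨ *-congˡ (*-congˡ (trans (↓-last (a ℕ.+ e) (e ℕ.+ d)) (*-congˡ (reflexive (≡.cong [_]
             (≡.trans (≡.cong (_∸ (e ℕ.+ d)) (≡.sym (ℕₚ.+-suc (e ℕ.+ d) e))) (ℕₚ.m+n∸m≡n (e ℕ.+ d) (suc e)))))))) ⟩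
      coef * (1# * ([ a ℕ.+ e ]↓ (e ℕ.+ d) * [ suc e ]))
        ≈⟨ solve 5 (λ x p i y b → x :* p :* i :* (con 1 :* (y :* b)) := x :* y :* p :* (b :* i))
             refl _ _ _ _ _ ⟩
      q ^ (r ℕ.* e) * [ a ℕ.+ e ]↓ (e ℕ.+ d) * P * ([ suc e ] * [ suc e ] ⁻¹)
        ≈⟨ *-congˡ (⁻¹-inverse _ ([suc]≉0 e)) ⟩
      q ^ (r ℕ.* e) * [ a ℕ.+ e ]↓ (e ℕ.+ d) * P * 1#
        ≈⟨ *-identityʳ _ ⟩
      q ^ (r ℕ.* e) * [ a ℕ.+ e ]↓ (e ℕ.+ d) * P ∎
    summand : ∀ t → coef * f t ≈
      Q t * [ r ℕ.+ t choose r ] * ([ a ℕ.+ e ∸ t ]↓ a * [ suc e ] ⁻¹) * pochhammer (r ℕ.+ s) (r ℕ.+ t)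
    summand t = begin
      q ^ (r ℕ.* e) * P * [ suc e ] ⁻¹ * (pochhammer s t * [ a ℕ.+ e ∸ t ]↓ a)
        ≈⟨ *-congʳ (*-congʳ (*-congʳ (Q-spec t))) ⟨
      Q t * q ^ (r ℕ.* t) * P * [ suc e ] ⁻¹ * (pochhammer s t * [ a ℕ.+ e ∸ t ]↓ a)
        ≈⟨ solve 6 (λ x y p i c n → x :* y :* p :* i :* (c :* n) := x :* (n :* i) :* (y :* p :* c))
             refl _ _ _ _ _ _ ⟩
      Q t * ([ a ℕ.+ e ∸ t ]↓ a * [ suc e ] ⁻¹) * (q ^ (r ℕ.* t) * P * pochhammer s t)
        ≈⟨ *-congˡ (pochhammer-trinomial r s t) ⟨
      Q t * ([ a ℕ.+ e ∸ t ]↓ a * [ suc e ] ⁻¹) * (pochhammer (r ℕ.+ s) (r ℕ.+ t) * [ r ℕ.+ t choose r ])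
        ≈⟨ solve 4 (λ x y p c → x :* y :* (p :* c) := x :* c :* y :* p) refl _ _ _ _ ⟩
      Q t * [ r ℕ.+ t choose r ] * ([ a ℕ.+ e ∸ t ]↓ a * [ suc e ] ⁻¹) * pochhammer (r ℕ.+ s) (r ℕ.+ t) ∎

  -- Coefficients of polynomials in x

  module 𝔽[x] = Polynomial ring
  open 𝔽[x] using (coeff; _·_; coeff-+; coeff-·; polynomialRing)
  private module ∑ᴾ = BigOperators polynomialRing

  coeff-∑ : ∀ {A : Set} (xs : List A) f j →
            coeff (∑ᴾ.∑ xs f) j ≈ ∑[ x ∈ xs ] coeff (f x) j
  coeff-∑ []       f j = refl
  coeff-∑ (x ∷ xs) f j = trans (coeff-+ (f x) _ j) (+-congˡ (coeff-∑ xs f j))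

  coeff-*-linear : ∀ p a j → coeff (p 𝔽[x].*ᴾ (1# ∷ a ∷ [])) (suc j) ≈ coeff p (suc j) + a * coeff p j
  coeff-*-linear p a j = begin
    coeff (p 𝔽[x].*ᴾ (1# ∷ a ∷ [])) (suc j)
      ≈⟨ 𝔽[x].at (𝔽[x].*ᴾ-comm p (1# ∷ a ∷ [])) (suc j) ⟩
    coeff (1# · p 𝔽[x].+ᴾ (0# ∷ (a · p 𝔽[x].+ᴾ (0# ∷ [])))) (suc j)
      ≈⟨ coeff-+ (1# · p) _ (suc j) ⟩
    coeff (1# · p) (suc j) + coeff (a · p 𝔽[x].+ᴾ (0# ∷ [])) j
      ≈⟨ +-cong (𝔽[x].at (𝔽[x].1·p p) (suc j)) (trans (coeff-+ (a · p) _ j)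
           (trans (+-cong (coeff-· a p j) (𝔽[x].at 𝔽[x].0∷[] j)) (+-identityʳ _))) ⟩
    coeff p (suc j) + a * coeff p j ∎

  coeff-*-linear-0 : ∀ p a → coeff (p 𝔽[x].*ᴾ (1# ∷ a ∷ [])) 0 ≈ coeff p 0
  coeff-*-linear-0 p a = begin
    coeff (p 𝔽[x].*ᴾ (1# ∷ a ∷ [])) 0    ≈⟨ 𝔽[x].at (𝔽[x].*ᴾ-comm p (1# ∷ a ∷ [])) 0 ⟩
    coeff (1# · p 𝔽[x].+ᴾ (0# ∷ (a · p 𝔽[x].+ᴾ (0# ∷ [])))) 0   ≈⟨ coeff-+ (1# · p) _ 0 ⟩
    coeff (1# · p) 0 + 0#                ≈⟨ +-identityʳ _ ⟩
    coeff (1# · p) 0                     ≈⟨ 𝔽[x].at (𝔽[x].1·p p) 0 ⟩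
    coeff p 0                            ∎

  -- (x;q)ₛ as a polynomial in x.
  qPochhammer : ℕ → 𝔽[x].Poly
  qPochhammer s = ∑ᴾ.∏ (upTo s) λ i → 1# ∷ - (q ^ i) ∷ []

  qPochhammer-suc : ∀ s → qPochhammer (suc s) 𝔽[x].≈ᴾ qPochhammer s 𝔽[x].*ᴾ (1# ∷ - (q ^ s) ∷ [])
  qPochhammer-suc s = BigOperatorProperties.∏-snoc polynomialRing (λ i → i) s _

  coeff-qPochhammer : ∀ s j → coeff (qPochhammer s) j ≈ pochhammer s j
  coeff-qPochhammer zero    zero    = refl
  coeff-qPochhammer zero    (suc j) = refl
  coeff-qPochhammer (suc s) zero    = trans (𝔽[x].at (qPochhammer-suc s) 0)
    (trans (coeff-*-linear-0 (qPochhammer s) _) (coeff-qPochhammer s zero))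
  coeff-qPochhammer (suc s) (suc j) = trans (𝔽[x].at (qPochhammer-suc s) (suc j))
    (trans (coeff-*-linear (qPochhammer s) _ j)
           (+-cong (coeff-qPochhammer s (suc j)) (*-congˡ (coeff-qPochhammer s j))))

  -- Integer powers of q

  qⁿ≉0 : ¬ (q ≈ 0#) → ∀ a → ¬ (q ^ a ≈ 0#)
  qⁿ≉0 q≉0 zero    = 1≉0
  qⁿ≉0 q≉0 (suc a) = *-nonzero q≉0 (qⁿ≉0 q≉0 a)

  -- Integer powers of q given by any function that has the expected values at
  -- nonnegative and at negative exponents.
  module IntegerPowers (q≉0 : ¬ (q ≈ 0#)) (q^_ : ℤ → Carrier)
                       (q^-pos : ∀ a → q^ (+ a) ≈ q ^ a)
                       (q^-neg : ∀ a → q^ -[1+ a ] ≈ (q ^ suc a) ⁻¹) where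

    q^-suc : ∀ x → q^ (ℤ.suc x) ≈ q * q^ x
    q^-suc (+ a)        = trans (q^-pos (suc a)) (*-congˡ (sym (q^-pos a)))
    q^-suc -[1+ zero ]  = begin
      q^ (+ 0)               ≈⟨ q^-pos 0 ⟩
      1#                     ≈⟨ ⁻¹-inverse _ (qⁿ≉0 q≉0 1) ⟨
      q * 1# * (q ^ 1) ⁻¹    ≈⟨ *-cong (*-identityʳ q) (sym (q^-neg 0)) ⟩
      q * q^ -[1+ 0 ]        ∎
    q^-suc -[1+ suc a ] = *-cancelˡ (qⁿ≉0 q≉0 (suc a)) (begin
      q ^ suc a * q^ -[1+ a ]                ≈⟨ *-congˡ (q^-neg a) ⟩
      q ^ suc a * (q ^ suc a) ⁻¹             ≈⟨ ⁻¹-inverse _ (qⁿ≉0 q≉0 (suc a)) ⟩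
      1#                                     ≈⟨ ⁻¹-inverse _ (qⁿ≉0 q≉0 (2 ℕ.+ a)) ⟨
      q * q ^ suc a * (q ^ (2 ℕ.+ a)) ⁻¹     ≈⟨ *-congˡ (q^-neg (suc a)) ⟨
      q * q ^ suc a * q^ -[1+ suc a ]        ≈⟨ *-congʳ (*-comm q (q ^ suc a)) ⟩
      q ^ suc a * q * q^ -[1+ suc a ]        ≈⟨ *-assoc _ _ _ ⟩
      q ^ suc a * (q * q^ -[1+ suc a ])      ∎)

    q^-+ⁿ : ∀ x n → q^ (x ℤ.+ + n) ≈ q^ x * q ^ n
    q^-+ⁿ x zero    = trans (reflexive (≡.cong q^_ (ℤₚ.+-identityʳ x))) (sym (*-identityʳ _))
    q^-+ⁿ x (suc n) = begin
      q^ (x ℤ.+ + suc n)          ≡⟨ ≡.cong q^_ (ℤ-suc x (+ n)) ⟩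
      q^ (ℤ.suc (x ℤ.+ + n))      ≈⟨ q^-suc (x ℤ.+ + n) ⟩
      q * q^ (x ℤ.+ + n)          ≈⟨ *-congˡ (q^-+ⁿ x n) ⟩
      q * (q^ x * q ^ n)          ≈⟨ solve 3 (λ a b c → a :* (b :* c) := b :* (a :* c)) refl _ _ _ ⟩
      q^ x * q ^ suc n            ∎
      where
      ℤ-suc : ∀ x y → x ℤ.+ (+ 1 ℤ.+ y) ≡ + 1 ℤ.+ (x ℤ.+ y)
      ℤ-suc = ℤ-Solver.solve-∀

    -- The exponent r (e - t) may be negative.
    q^-shift : ∀ r e t → q^ (+ r ℤ.* (+ e ℤ.- + t)) * q ^ (r ℕ.* t) ≈ q ^ (r ℕ.* e)
    q^-shift r e t = begin
      q^ (+ r ℤ.* (+ e ℤ.- + t)) * q ^ (r ℕ.* t)       ≈⟨ q^-+ⁿ _ (r ℕ.* t) ⟨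
      q^ (+ r ℤ.* (+ e ℤ.- + t) ℤ.+ + (r ℕ.* t))       ≡⟨ ≡.cong q^_ exponents ⟩
      q^ (+ (r ℕ.* e))                                 ≈⟨ q^-pos (r ℕ.* e) ⟩
      q ^ (r ℕ.* e)                                    ∎
      where
      collect : ∀ x y z → x ℤ.* (y ℤ.- z) ℤ.+ x ℤ.* z ≡ x ℤ.* y
      collect = ℤ-Solver.solve-∀
      exponents : + r ℤ.* (+ e ℤ.- + t) ℤ.+ + (r ℕ.* t) ≡ + (r ℕ.* e)
      exponents = ≡.trans (≡.cong (λ x → + r ℤ.* (+ e ℤ.- + t) ℤ.+ x) (ℤₚ.pos-* r t))
        (≡.trans (collect (+ r) (+ e) (+ t)) (≡.sym (ℤₚ.pos-* r e)))

    -- The power of q that accompanies the i-th rook number on a board with m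
    -- columns; of it only the dependence on m matters.
    rookPower : ℕ → ℕ → Carrier
    rookPower m i = q^ (+ (m ℕ.* i) ℤ.- + (i C 2))

    rookPower-+ : ∀ m e i → rookPower (m ℕ.+ e) i ≈ q ^ (e ℕ.* i) * rookPower m i
    rookPower-+ m e i = begin
      q^ (+ ((m ℕ.+ e) ℕ.* i) ℤ.- + (i C 2))
        ≡⟨ ≡.cong q^_ (≡.trans (≡.cong (λ x → + x ℤ.- + (i C 2)) (ℕₚ.*-distribʳ-+ i m e))
             (swap (+ (m ℕ.* i)) (+ (e ℕ.* i)) (+ (i C 2)))) ⟩
      q^ (+ (m ℕ.* i) ℤ.- + (i C 2) ℤ.+ + (e ℕ.* i))
        ≈⟨ q^-+ⁿ (+ (m ℕ.* i) ℤ.- + (i C 2)) (e ℕ.* i) ⟩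
      rookPower m i * q ^ (e ℕ.* i)   ≈⟨ *-comm _ _ ⟩
      q ^ (e ℕ.* i) * rookPower m i   ∎
      where
      swap : ∀ x y z → (x ℤ.+ y) ℤ.- z ≡ x ℤ.- z ℤ.+ y
      swap = ℤ-Solver.solve-∀

  -- Hit numbers of an arbitrary sequence

  -- Hit numbers with an arbitrary sequence ρ in place of the rook numbers; κ
  -- stands for q^(-|λ|) and ε i for (-1)ⁱ.
  module HitNumbers (q≉0 : ¬ (q ≈ 0#)) (q^_ : ℤ → Carrier)
                    (q^-pos : ∀ a → q^ (+ a) ≈ q ^ a)
                    (q^-neg : ∀ a → q^ -[1+ a ] ≈ (q ^ suc a) ⁻¹)
                    (κ : Carrier) (ρ ε : ℕ → Carrier) where
    open IntegerPowers q≉0 q^_ q^-pos q^-neg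

    -- The factor of (x;q)ᵢ in the hit polynomial of the n × m board.
    weight : ℕ → ℕ → ℕ → Carrier
    weight m n i = κ * [ m ∸ n ]! ⁻¹ * (ρ i * [ m ∸ i ]! * ε i * rookPower m i)

    -- The hit numbers written out as sums over rook numbers.
    hit : ℕ → ℕ → ℕ → Carrier
    hit m n j = ∑[ i ∈ range 0 n ] weight m n i * pochhammer i j

    -- The polynomial whose coefficients are the hit numbers.
    hitPoly : ℕ → ℕ → 𝔽[x].Poly
    hitPoly m n = (κ * [ m ∸ n ]! ⁻¹) · ∑ᴾ.∑ (range 0 n) λ i →
      (ρ i * [ m ∸ i ]! * ε i * rookPower m i) · qPochhammer i

    H : ℕ → ℕ → ℕ → Carrier
    H m n j = coeff (hitPoly m n) j

    H≈hit : ∀ m n j → H m n j ≈ hit m n j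
    H≈hit m n j = begin
      coeff (hitPoly m n) j
        ≈⟨ coeff-· (κ * [ m ∸ n ]! ⁻¹) (∑ᴾ.∑ (range 0 n) summand) j ⟩
      κ * [ m ∸ n ]! ⁻¹ * coeff (∑ᴾ.∑ (range 0 n) summand) j
        ≈⟨ *-congˡ (coeff-∑ (range 0 n) summand j) ⟩
      κ * [ m ∸ n ]! ⁻¹ * (∑[ i ∈ range 0 n ] coeff (summand i) j)
        ≈⟨ ∑-*ˡ (range 0 n) (κ * [ m ∸ n ]! ⁻¹) _ ⟩
      (∑[ i ∈ range 0 n ] κ * [ m ∸ n ]! ⁻¹ * coeff (summand i) j)
        ≈⟨ ∑-cong (range 0 n) (λ i → trans
             (*-congˡ (trans (coeff-· _ (qPochhammer i) j) (*-congˡ (coeff-qPochhammer i j))))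
             (sym (*-assoc _ _ _))) ⟩
      hit m n j ∎
      where
      summand : ℕ → 𝔽[x].Poly
      summand i = (ρ i * [ m ∸ i ]! * ε i * rookPower m i) · qPochhammer i

    weight-zero : ∀ m n i {p} → ρ i ≈ 0# → weight m n i * p ≈ 0#
    weight-zero m n i {p} ρi≈0 = begin
      κ * [ m ∸ n ]! ⁻¹ * (ρ i * [ m ∸ i ]! * ε i * rookPower m i) * p
        ≈⟨ solve 6 (λ k r g e z p → k :* (r :* g :* e :* z) :* p := r :* (k :* (g :* e :* z) :* p))
             refl _ _ _ _ _ _ ⟩
      ρ i * (κ * [ m ∸ n ]! ⁻¹ * ([ m ∸ i ]! * ε i * rookPower m i) * p)   ≈⟨ trans (*-congʳ ρi≈0) (zeroˡ _) ⟩
      0# ∎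

    -- If ρ vanishes beyond n, the sum for any larger square board stops at n.
    hit-truncate : ∀ {n N} j → n ≤ N → (∀ i → n < i → ρ i ≈ 0#) →
                   hit N N j ≈ ∑[ i ∈ range 0 n ] weight N N i * pochhammer i j
    hit-truncate {n} j n≤N ρ≈0 with ℕₚ.m≤n⇒∃[o]m+o≡n n≤N
    ... | o , ≡.refl = ∑-truncate (0 ℕ.+_) _ (suc n) o
      (λ i n<i → weight-zero (n ℕ.+ o) (n ℕ.+ o) i (ρ≈0 i n<i))

    -- Reduces an identity between weights for the square board of size m + e and
    -- the n × m board to one between q-factorials: κ, ρ i, ε i and rookPower m i
    -- are common factors, and [0]! = 1 disappears from the square board.
    compare-weights : ∀ m e d i {n X Y P} → m ∸ n ≡ d →
      X * [ m ℕ.+ e ∸ i ]! * q ^ (e ℕ.* i) * P ≈ [ d ]! ⁻¹ * [ m ∸ i ]! * Y →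
      X * (weight (m ℕ.+ e) (m ℕ.+ e) i * P) ≈ weight m n i * Y
    compare-weights m e d i {n} {X} {Y} {P} ≡.refl eq = begin
      X * (κ * [ m ℕ.+ e ∸ (m ℕ.+ e) ]! ⁻¹ * (ρ i * G * ε i * rookPower (m ℕ.+ e) i) * P)
        ≈⟨ *-congˡ (*-congʳ (*-cong (*-congˡ (trans (reflexive (≡.cong (λ o → [ o ]! ⁻¹) (ℕₚ.n∸n≡0 (m ℕ.+ e))))
             (trans (sym (*-identityˡ _)) (!-inverse 0)))) (*-congˡ (rookPower-+ m e i)))) ⟩
      X * (κ * 1# * (ρ i * G * ε i * (q ^ (e ℕ.* i) * rookPower m i)) * P)
        ≈⟨ solve 8 (λ x k r g s p z c →
             x :* (k :* con 1 :* (r :* g :* s :* (p :* z)) :* c) :=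
             k :* r :* s :* z :* (x :* g :* p :* c)) refl _ _ _ _ _ _ _ _ ⟩
      κ * ρ i * ε i * rookPower m i * (X * G * q ^ (e ℕ.* i) * P)
        ≈⟨ *-congˡ eq ⟩
      κ * ρ i * ε i * rookPower m i * ([ m ∸ n ]! ⁻¹ * [ m ∸ i ]! * Y)
        ≈⟨ solve 7 (λ k r s z i g y → k :* r :* s :* z :* (i :* g :* y) :=
             k :* i :* (r :* g :* s :* z) :* y) refl _ _ _ _ _ _ _ ⟩
      weight m n i * Y ∎
      where G = [ m ℕ.+ e ∸ i ]!

    -- The two identities in terms of the differences d = m - n and b = n - k,
    -- respectively e = n - r - 1, which leaves few truncated subtractions.  Only
    -- the term i = k contributes to hit-top, because ρ vanishes above k and
    -- pochhammer below.
    hit-top : ∀ k b d → let a = b ℕ.+ d in (∀ i → k < i → ρ i ≈ 0#) →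
      [ a choose b ] * H (k ℕ.+ a ℕ.+ b) (k ℕ.+ a ℕ.+ b) k ≈
      q ^ (k ℕ.* b) * [ a ℕ.+ b ]↓ a * H (k ℕ.+ a) (k ℕ.+ b) k
    hit-top k b d ρ≈0 = begin
      [ a choose b ] * H N N k
        ≈⟨ *-congˡ (H≈hit N N k) ⟩
      [ a choose b ] * hit N N k
        ≈⟨ *-congˡ (hit-truncate k n≤N (λ i n<i → ρ≈0 i (ℕₚ.≤-<-trans (ℕₚ.m≤m+n k b) n<i))) ⟩
      [ a choose b ] * (∑[ i ∈ range 0 n ] weight N N i * pochhammer i k)
        ≈⟨ ∑-*ˡ (range 0 n) _ _ ⟩
      (∑[ i ∈ range 0 n ] [ a choose b ] * (weight N N i * pochhammer i k))
        ≈⟨ ∑-cong (range 0 n) term ⟩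
      (∑[ i ∈ range 0 n ] A * (weight m n i * pochhammer i k))
        ≈⟨ ∑-*ˡ (range 0 n) _ _ ⟨
      A * hit m n k
        ≈⟨ *-congˡ (H≈hit m n k) ⟨
      A * H m n k ∎
      where
      a = b ℕ.+ d
      m = k ℕ.+ a
      n = k ℕ.+ b
      N = m ℕ.+ b
      A = q ^ (k ℕ.* b) * [ a ℕ.+ b ]↓ a
      n≤N : n ≤ N
      n≤N = ℕₚ.+-monoˡ-≤ b (ℕₚ.m≤m+n k a)
      m∸n : m ∸ n ≡ d
      m∸n = ≡.trans (ℕₚ.[m+n]∸[m+o]≡n∸o k a b) (ℕₚ.m+n∸m≡n b d)
      term : ∀ i → [ a choose b ] * (weight N N i * pochhammer i k) ≈ A * (weight m n i * pochhammer i k)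
      term i with ℕₚ.<-cmp i k
      ... | tri< i<k _ _ = trans (trans (*-congˡ vanish) (zeroʳ _)) (sym (trans (*-congˡ vanish) (zeroʳ _)))
        where
        vanish : ∀ {w} → w * pochhammer i k ≈ 0#
        vanish = trans (*-congˡ (pochhammer-zero i<k)) (zeroʳ _)
      ... | tri> _ _ k<i = trans (trans (*-congˡ (weight-zero N N i (ρ≈0 i k<i))) (zeroʳ _))
        (sym (trans (*-congˡ (weight-zero m n i (ρ≈0 i k<i))) (zeroʳ _)))
      ... | tri≈ _ ≡.refl _ = trans
        (compare-weights m b d k {n} {Y = A * pochhammer k k} m∸n (begin
          [ a choose b ] * [ m ℕ.+ b ∸ k ]! * q ^ (b ℕ.* k) * pochhammer k k
            ≈⟨ *-congʳ (*-cong (*-congˡ (reflexive (≡.cong [_]!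
                   (≡.trans (≡.cong (_∸ k) (ℕₚ.+-assoc k a b)) (ℕₚ.m+n∸m≡n k (a ℕ.+ b))))))
                 (^-congʳ q (ℕₚ.*-comm b k))) ⟩
          [ a choose b ] * [ a ℕ.+ b ]! * q ^ (k ℕ.* b) * pochhammer k k
            ≈⟨ *-congʳ (*-congʳ (top-term b d)) ⟩
          [ d ]! ⁻¹ * [ a ]! * [ a ℕ.+ b ]↓ a * q ^ (k ℕ.* b) * pochhammer k k
            ≈⟨ solve 5 (λ i g f p c → i :* g :* f :* p :* c := i :* g :* (p :* f :* c)) refl _ _ _ _ _ ⟩
          [ d ]! ⁻¹ * [ a ]! * (A * pochhammer k k)
            ≈⟨ *-congʳ (*-congˡ (reflexive (≡.cong [_]! (ℕₚ.m+n∸m≡n k a)))) ⟨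
          [ d ]! ⁻¹ * [ m ∸ k ]! * (A * pochhammer k k) ∎))
        (solve 3 (λ w x y → w :* (x :* y) := x :* (w :* y)) refl _ _ _)

    hit-lower : ∀ r e d → let a = suc e ℕ.+ d in
      (∀ i → r ℕ.+ suc e < i → ρ i ≈ 0#) →
      [ a choose suc e ] * H (r ℕ.+ a ℕ.+ e) (r ℕ.+ a ℕ.+ e) r ≈
      q ^ (r ℕ.* e) * [ a ℕ.+ e ]↓ (e ℕ.+ d) * H (r ℕ.+ a) (r ℕ.+ suc e) r +
      ∑[ t ∈ applyUpTo suc (suc e) ]
        q^ (+ r ℤ.* (+ e ℤ.- + t)) * [ r ℕ.+ t choose r ] * ([ a ℕ.+ e ∸ t ]↓ a * [ suc e ] ⁻¹)
          * H (r ℕ.+ a) (r ℕ.+ suc e) (r ℕ.+ t)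
    hit-lower r e d ρ≈0 = begin
      [ a choose suc e ] * H N N r
        ≈⟨ *-congˡ (H≈hit N N r) ⟩
      [ a choose suc e ] * hit N N r
        ≈⟨ *-congˡ (hit-truncate r n≤N ρ≈0) ⟩
      [ a choose suc e ] * (∑[ i ∈ range 0 n ] weight N N i * pochhammer i r)
        ≈⟨ ∑-*ˡ (range 0 n) _ _ ⟩
      (∑[ i ∈ range 0 n ] [ a choose suc e ] * (weight N N i * pochhammer i r))
        ≈⟨ ∑-applyUpTo-cong (0 ℕ.+_) (0 ℕ.+_) _ _ (suc n) (λ i i≤n → term i (ℕ.s≤s⁻¹ i≤n)) ⟩
      (∑[ i ∈ range 0 n ] weight m n i *
        (A * pochhammer i r + ∑[ t ∈ applyUpTo suc (suc e) ] B t * pochhammer i (r ℕ.+ t)))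
        ≈⟨ ∑-collect (range 0 n) (applyUpTo suc (suc e)) (weight m n) A B _ _ ⟨
      A * hit m n r + (∑[ t ∈ applyUpTo suc (suc e) ] B t * hit m n (r ℕ.+ t))
        ≈⟨ +-cong (*-congˡ (H≈hit m n r))
             (∑-cong (applyUpTo suc (suc e)) (λ t → *-congˡ (H≈hit m n (r ℕ.+ t)))) ⟨
      A * H m n r + (∑[ t ∈ applyUpTo suc (suc e) ] B t * H m n (r ℕ.+ t)) ∎
      where
      a = suc e ℕ.+ d
      m = r ℕ.+ a
      n = r ℕ.+ suc e
      N = m ℕ.+ e
      A = q ^ (r ℕ.* e) * [ a ℕ.+ e ]↓ (e ℕ.+ d)
      B : ℕ → Carrier
      B t = q^ (+ r ℤ.* (+ e ℤ.- + t)) * [ r ℕ.+ t choose r ] * ([ a ℕ.+ e ∸ t ]↓ a * [ suc e ] ⁻¹)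
      n≤N : n ≤ N
      n≤N = ℕₚ.≤-trans (ℕₚ.+-monoʳ-≤ r (ℕₚ.m≤m+n (suc e) d)) (ℕₚ.m≤m+n m e)
      m∸n : m ∸ n ≡ d
      m∸n = ≡.trans (ℕₚ.[m+n]∸[m+o]≡n∸o r a (suc e)) (ℕₚ.m+n∸m≡n (suc e) d)
      term : ∀ i → i ≤ n → [ a choose suc e ] * (weight N N i * pochhammer i r) ≈
        weight m n i * (A * pochhammer i r + ∑[ t ∈ applyUpTo suc (suc e) ] B t * pochhammer i (r ℕ.+ t))
      term i i≤n with ℕₚ.≤-<-connex r i
      ... | inj₂ i<r = begin
        [ a choose suc e ] * (weight N N i * pochhammer i r)
          ≈⟨ *-congˡ (trans (*-congˡ (pochhammer-zero i<r)) (zeroʳ _)) ⟩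
        [ a choose suc e ] * 0#                            ≈⟨ zeroʳ _ ⟩
        0#                                                 ≈⟨ zeroʳ _ ⟨
        weight m n i * 0#
          ≈⟨ *-congˡ (trans (+-cong (trans (*-congˡ (pochhammer-zero i<r)) (zeroʳ A))
               (∑-zero (applyUpTo suc (suc e)) _ (λ t → trans
                 (*-congˡ (pochhammer-zero (ℕₚ.<-≤-trans i<r (ℕₚ.m≤m+n r t)))) (zeroʳ (B t)))))
               (+-identityˡ 0#)) ⟨
        weight m n i * (A * pochhammer i r + ∑[ t ∈ applyUpTo suc (suc e) ] B t * pochhammer i (r ℕ.+ t)) ∎
      ... | inj₁ r≤i with ℕₚ.m≤n⇒∃[o]m+o≡n r≤i
      ... | s , ≡.refl = compare-weights m e d (r ℕ.+ s) {n} m∸n (begin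
        [ a choose suc e ] * [ m ℕ.+ e ∸ (r ℕ.+ s) ]! * q ^ (e ℕ.* (r ℕ.+ s)) * pochhammer (r ℕ.+ s) r
          ≡⟨ ≡.cong (λ o → [ a choose suc e ] * [ o ]! * q ^ (e ℕ.* (r ℕ.+ s)) * pochhammer (r ℕ.+ s) r)
               (≡.trans (≡.cong (_∸ (r ℕ.+ s)) (ℕₚ.+-assoc r a e)) (ℕₚ.[m+n]∸[m+o]≡n∸o r (a ℕ.+ e) s)) ⟩
        [ a choose suc e ] * [ a ℕ.+ e ∸ s ]! * q ^ (e ℕ.* (r ℕ.+ s)) * pochhammer (r ℕ.+ s) r
          ≈⟨ lower-term e d r s _ (ℕₚ.+-cancelˡ-≤ r _ _ i≤n) (q^-shift r e) ⟩
        [ d ]! ⁻¹ * [ a ∸ s ]! * _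
          ≡⟨ ≡.cong (λ o → [ d ]! ⁻¹ * [ o ]! * (A * pochhammer (r ℕ.+ s) r +
               ∑[ t ∈ applyUpTo suc (suc e) ] B t * pochhammer (r ℕ.+ s) (r ℕ.+ t))) (ℕₚ.[m+n]∸[m+o]≡n∸o r a s) ⟨
        [ d ]! ⁻¹ * [ m ∸ (r ℕ.+ s) ]! * _ ∎)

    private
      ∸-unique : ∀ {s} c {x} → s ≡ c ℕ.+ x → s ∸ c ≡ x
      ∸-unique c {x} ≡.refl = ℕₚ.m+n∸m≡n c x

    -- The same two identities in terms of m, n, k and m, n, r.
    hit-identity-top : ∀ {m n k} → k ≤ n → n ≤ m → (∀ i → k < i → ρ i ≈ 0#) →
      [ m ∸ k choose n ∸ k ] * H (m ℕ.+ n ∸ k) (m ℕ.+ n ∸ k) k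
        ≈ q^ (+ k ℤ.* (+ n ℤ.- + k)) * [ m ℕ.+ n ∸ 2 ℕ.* k ]↓ (m ∸ k) * H m n k
    hit-identity-top {m} {n} {k} k≤n n≤m ρ≈0 with ℕₚ.m≤n⇒∃[o]m+o≡n k≤n
    ... | b , ≡.refl with ℕₚ.m≤n⇒∃[o]m+o≡n n≤m
    ... | d , ≡.refl = begin
      [ m ∸ k choose n ∸ k ] * H (m ℕ.+ n ∸ k) (m ℕ.+ n ∸ k) k
        ≡⟨ ≡.cong₂ _*_ (≡.cong₂ [_choose_] m∸k n∸k) (≡.cong (λ N → H N N k) (∸-unique k (size k b d))) ⟩
      [ b ℕ.+ d choose b ] * H (k ℕ.+ (b ℕ.+ d) ℕ.+ b) (k ℕ.+ (b ℕ.+ d) ℕ.+ b) k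
        ≈⟨ hit-top k b d ρ≈0 ⟩
      q ^ (k ℕ.* b) * [ b ℕ.+ d ℕ.+ b ]↓ (b ℕ.+ d) * H (k ℕ.+ (b ℕ.+ d)) n k
        ≈⟨ *-cong (*-cong (trans (reflexive (≡.cong q^_ exponent)) (q^-pos (k ℕ.* b)))
                          (reflexive (≡.cong₂ [_]↓_ (∸-unique (2 ℕ.* k) (total k b d)) m∸k)))
                  (reflexive (≡.cong (λ M → H M n k) (ℕₚ.+-assoc k b d))) ⟨
      q^ (+ k ℤ.* (+ n ℤ.- + k)) * [ m ℕ.+ n ∸ 2 ℕ.* k ]↓ (m ∸ k) * H m n k ∎
      where
      m∸k : k ℕ.+ b ℕ.+ d ∸ k ≡ b ℕ.+ d
      m∸k = ∸-unique k (ℕₚ.+-assoc k b d)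
      n∸k : k ℕ.+ b ∸ k ≡ b
      n∸k = ℕₚ.m+n∸m≡n k b
      size : ∀ k b d → k ℕ.+ b ℕ.+ d ℕ.+ (k ℕ.+ b) ≡ k ℕ.+ (k ℕ.+ (b ℕ.+ d) ℕ.+ b)
      size = ℕ-Solver.solve-∀
      total : ∀ k b d → k ℕ.+ b ℕ.+ d ℕ.+ (k ℕ.+ b) ≡ 2 ℕ.* k ℕ.+ (b ℕ.+ d ℕ.+ b)
      total = ℕ-Solver.solve-∀
      expand : ∀ x y → x ℤ.* (x ℤ.+ y ℤ.- x) ≡ x ℤ.* y
      expand = ℤ-Solver.solve-∀
      exponent : + k ℤ.* (+ (k ℕ.+ b) ℤ.- + k) ≡ + (k ℕ.* b)
      exponent = ≡.trans (expand (+ k) (+ b)) (≡.sym (ℤₚ.pos-* k b))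

    hit-identity-lower : ∀ {m n r} → r < n → n ≤ m → (∀ i → n < i → ρ i ≈ 0#) →
      [ m ∸ r choose n ∸ r ] * H (m ℕ.+ n ∸ r ∸ 1) (m ℕ.+ n ∸ r ∸ 1) r
      ≈ q^ (+ r ℤ.* (+ n ℤ.- + r ℤ.- + 1)) * [ m ℕ.+ n ∸ 2 ℕ.* r ∸ 1 ]↓ (m ∸ r ∸ 1) * H m n r
      + ( ∑[ j ∈ range (suc r) n ] q^ (+ r ℤ.* (+ n ℤ.- + 1 ℤ.- + j)) * [ j choose r ]
          * ([ m ℕ.+ n ∸ r ∸ j ∸ 1 ]↓ (m ∸ r) * [ n ∸ r ] ⁻¹) * H m n j )
    hit-identity-lower {m} {n} {r} r<n n≤m ρ≈0 with ℕₚ.m≤n⇒∃[o]m+o≡n r<n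
    ... | e , ≡.refl with ℕₚ.m≤n⇒∃[o]m+o≡n n≤m
    ... | d , ≡.refl = begin
      [ m ∸ r choose n ∸ r ] * H (m ℕ.+ n ∸ r ∸ 1) (m ℕ.+ n ∸ r ∸ 1) r
        ≡⟨ ≡.cong₂ _*_ (≡.cong₂ [_choose_] m∸r n∸r)
             (≡.cong (λ N → H N N r) (≡.trans (ℕₚ.∸-+-assoc (m ℕ.+ n) r 1) (∸-unique (r ℕ.+ 1) (size r e d)))) ⟩
      [ a choose suc e ] * H (r ℕ.+ a ℕ.+ e) (r ℕ.+ a ℕ.+ e) r
        ≈⟨ hit-lower r e d (λ i n<i → ρ≈0 i (≡.subst (_< i) (ℕₚ.+-suc r e) n<i)) ⟩
      q ^ (r ℕ.* e) * [ a ℕ.+ e ]↓ (e ℕ.+ d) * H (r ℕ.+ a) (r ℕ.+ suc e) r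
        + (∑[ t ∈ applyUpTo suc (suc e) ]
             q^ (+ r ℤ.* (+ e ℤ.- + t)) * [ r ℕ.+ t choose r ] * ([ a ℕ.+ e ∸ t ]↓ a * [ suc e ] ⁻¹)
               * H (r ℕ.+ a) (r ℕ.+ suc e) (r ℕ.+ t))
        ≈⟨ +-cong
             (*-cong
               (*-cong (trans (reflexive (≡.cong q^_ exponent)) (q^-pos (r ℕ.* e)))
                       (reflexive (≡.cong₂ [_]↓_ top-index (≡.cong (_∸ 1) m∸r))))
               (reflexive (≡.cong₂ (λ M N → H M N r) m≡ n≡)))
             (trans
               (reflexive (≡.cong (λ c → ∑ (applyUpTo (suc r ℕ.+_) c) summand)
                 (∸-unique r (≡.sym (ℕₚ.+-suc r e)))))
               (∑-applyUpTo-cong (suc r ℕ.+_) suc summand _ (suc e) (λ t _ → reflexive (summand≡ t)))) ⟨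
      q^ (+ r ℤ.* (+ n ℤ.- + r ℤ.- + 1)) * [ m ℕ.+ n ∸ 2 ℕ.* r ∸ 1 ]↓ (m ∸ r ∸ 1) * H m n r
        + (∑[ j ∈ range (suc r) n ] summand j) ∎
      where
      a = suc e ℕ.+ d
      summand : ℕ → Carrier
      summand j = q^ (+ r ℤ.* (+ n ℤ.- + 1 ℤ.- + j)) * [ j choose r ]
          * ([ m ℕ.+ n ∸ r ∸ j ∸ 1 ]↓ (m ∸ r) * [ n ∸ r ] ⁻¹) * H m n j
      n≡ : suc r ℕ.+ e ≡ r ℕ.+ suc e
      n≡ = ≡.sym (ℕₚ.+-suc r e)
      m≡ : suc r ℕ.+ e ℕ.+ d ≡ r ℕ.+ (suc e ℕ.+ d)
      m≡ = ≡.trans (≡.cong (ℕ._+ d) n≡) (ℕₚ.+-assoc r (suc e) d)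
      m∸r : suc r ℕ.+ e ℕ.+ d ∸ r ≡ suc e ℕ.+ d
      m∸r = ∸-unique r m≡
      n∸r : suc r ℕ.+ e ∸ r ≡ suc e
      n∸r = ∸-unique r n≡
      size : ∀ r e d → suc r ℕ.+ e ℕ.+ d ℕ.+ (suc r ℕ.+ e) ≡ r ℕ.+ 1 ℕ.+ (r ℕ.+ (suc e ℕ.+ d) ℕ.+ e)
      size = ℕ-Solver.solve-∀
      total : ∀ r e d → suc r ℕ.+ e ℕ.+ d ℕ.+ (suc r ℕ.+ e) ≡ 2 ℕ.* r ℕ.+ 1 ℕ.+ (suc e ℕ.+ d ℕ.+ e)
      total = ℕ-Solver.solve-∀
      top-index : m ℕ.+ n ∸ 2 ℕ.* r ∸ 1 ≡ a ℕ.+ e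
      top-index = ≡.trans (ℕₚ.∸-+-assoc (m ℕ.+ n) (2 ℕ.* r) 1) (∸-unique (2 ℕ.* r ℕ.+ 1) (total r e d))
      shift : ∀ r t → r ℕ.+ (suc r ℕ.+ t) ℕ.+ 1 ≡ 2 ℕ.* r ℕ.+ 1 ℕ.+ suc t
      shift = ℕ-Solver.solve-∀
      index : ∀ t → m ℕ.+ n ∸ r ∸ (suc r ℕ.+ t) ∸ 1 ≡ a ℕ.+ e ∸ suc t
      index t = ≡.trans (≡.cong (_∸ 1) (ℕₚ.∸-+-assoc (m ℕ.+ n) r (suc r ℕ.+ t)))
        (≡.trans (ℕₚ.∸-+-assoc (m ℕ.+ n) (r ℕ.+ (suc r ℕ.+ t)) 1)
        (≡.trans (≡.cong₂ _∸_ (total r e d) (shift r t))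
                 (ℕₚ.[m+n]∸[m+o]≡n∸o (2 ℕ.* r ℕ.+ 1) (a ℕ.+ e) (suc t))))
      expand : ∀ x y → x ℤ.* (+ 1 ℤ.+ (x ℤ.+ y) ℤ.- x ℤ.- + 1) ≡ x ℤ.* y
      expand = ℤ-Solver.solve-∀
      exponent : + r ℤ.* (+ (suc r ℕ.+ e) ℤ.- + r ℤ.- + 1) ≡ + (r ℕ.* e)
      exponent = ≡.trans (expand (+ r) (+ e)) (≡.sym (ℤₚ.pos-* r e))
      expand-j : ∀ x y z → x ℤ.* (+ 1 ℤ.+ (x ℤ.+ y) ℤ.- + 1 ℤ.- (+ 1 ℤ.+ (x ℤ.+ z))) ≡ x ℤ.* (y ℤ.- (+ 1 ℤ.+ z))
      expand-j = ℤ-Solver.solve-∀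
      summand≡ : ∀ t → summand (suc r ℕ.+ t) ≡
        q^ (+ r ℤ.* (+ e ℤ.- + suc t)) * [ r ℕ.+ suc t choose r ] * ([ a ℕ.+ e ∸ suc t ]↓ a * [ suc e ] ⁻¹)
          * H (r ℕ.+ a) (r ℕ.+ suc e) (r ℕ.+ suc t)
      summand≡ t = ≡.cong₂ _*_
        (≡.cong₂ _*_
          (≡.cong₂ _*_ (≡.cong q^_ (expand-j (+ r) (+ e) (+ t))) (≡.cong [_choose r ] j≡))
          (≡.cong₂ _*_ (≡.cong₂ [_]↓_ (index t) m∸r) (≡.cong (λ c → [ c ] ⁻¹) n∸r)))
        (≡.trans (≡.cong₂ (λ M N → H M N (suc r ℕ.+ t)) m≡ n≡) (≡.cong (λ j → H (r ℕ.+ a) (r ℕ.+ suc e) j) j≡))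
        where
        j≡ : suc r ℕ.+ t ≡ r ℕ.+ suc t
        j≡ = ≡.sym (ℕₚ.+-suc r t)

open import Defs

private
  module KR = CommutativeRing K
  module ℤ[q]R = CommutativeRing ℤ[q].polynomialRing

-- Rook placements

-- The cells of row i, followed by cells ys: at most one rook stands in row i.
module _ {i : ℕ} {ys : List Cell} where

  ⊆-skip-row : ∀ {p} xs → p ⊆ List.map (i ,_) xs ++ ys → All (λ c → i ≢ row c) p → p ⊆ ys
  ⊆-skip-row []       p⊆         _            = p⊆
  ⊆-skip-row (x ∷ xs) (_ ∷ʳ p⊆)  other        = ⊆-skip-row xs p⊆ other
  ⊆-skip-row (x ∷ xs) (≡.refl ∷ _) (i≢i ∷ _)  = contradiction ≡.refl i≢i

  one-rook-per-row : ∀ {p B} xs → (∀ {p} → p ⊆ ys → NonAttacking p → length p ≤ B) →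
    p ⊆ List.map (i ,_) xs ++ ys → NonAttacking p → length p ≤ suc B
  one-rook-per-row []       bound p⊆             na        = ℕₚ.m≤n⇒m≤1+n (bound p⊆ na)
  one-rook-per-row (x ∷ xs) bound (_ ∷ʳ p⊆)      na        = one-rook-per-row xs bound p⊆ na
  one-rook-per-row (x ∷ xs) bound (≡.refl ∷ p⊆)  (h ∷ na)  =
    s≤s (bound (⊆-skip-row xs p⊆ (All.map proj₁ h)) na)

nonAttacking-length : ∀ i ls {p} → p ⊆ rowsFrom i ls → NonAttacking p →
                      length p ≤ length (filter (1 ℕₚ.≤?_) ls)
nonAttacking-length i []           []  _  = z≤n
nonAttacking-length i (zero  ∷ ls) p⊆  na = nonAttacking-length (suc i) ls p⊆ na
nonAttacking-length i (suc l ∷ ls) p⊆  na =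
  one-rook-per-row (range 1 (suc l)) (nonAttacking-length (suc i) ls) p⊆ na

sublistsOfLength-sound : ∀ {A : Set} k (xs : List A) →
                         All (λ p → p ⊆ xs × length p ≡ k) (sublistsOfLength k xs)
sublistsOfLength-sound zero    xs       = (minimum xs , ≡.refl) ∷ []
sublistsOfLength-sound (suc k) []       = []
sublistsOfLength-sound (suc k) (x ∷ xs) = Allₚ.++⁺
  (Allₚ.map⁺ (All.map (λ (s , e) → ≡.refl ∷ s , ≡.cong suc e) (sublistsOfLength-sound k xs)))
  (All.map (λ (s , e) → x ∷ʳ s , e) (sublistsOfLength-sound (suc k) xs))

placements-empty : ∀ k μ → ℓ μ < k → placements k μ ≡ []
placements-empty k μ ℓ<k = filter-none nonAttacking?
  (All.map (λ { (p⊆ , ≡.refl) na → ℕₚ.<⇒≱ ℓ<k (nonAttacking-length 1 (parts μ) p⊆ na) })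
           (sublistsOfLength-sound k (cells μ)))

R-zero : ∀ k μ → ℓ μ < k → R k μ ≈ 0#
R-zero k μ ℓ<k = KR.reflexive (≡.cong (λ ps → ∑[ p ∈ ps ] q ^ inv μ p) (placements-empty k μ ℓ<k))

-- The field of rational functions

-- In a product of copies of q all the denominators are 1.
den-q^ : ∀ a → ℚ⟨q⟩.Fraction.den (q ^ a) ℤ[q].≈ᴾ (ℤ.1ℤ ∷ [])
den-q^ zero    = ℤ[q].≈ᴾ-refl
den-q^ (suc a) = ℤ[q].≈ᴾ-trans (ℤ[q].*ᴾ-identityˡ (ℚ⟨q⟩.Fraction.den (q ^ a))) (den-q^ a)

-- The numerator of q^(a+1) has constant term 0, its denominator has constant
-- term 1.
q^suc≉1 : ∀ a → ¬ (q ^ suc a ≈ 1#)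
q^suc≉1 a e = contradiction
  (≡.trans (≡.sym den₀) (≡.trans (≡.sym rhs) (≡.trans (≡.sym (ℤ[q].at (ℚ⟨q⟩.cross e) 0)) lhs)))
  λ ()
  where
  N = ℚ⟨q⟩.Fraction.num (q ^ a)
  D = ℚ⟨q⟩.Fraction.den (q ^ suc a)
  X = ℤ.0ℤ ∷ ℤ.1ℤ ∷ []
  den₀ : ℤ[q].coeff D 0 ≡ ℤ.1ℤ
  den₀ = ℤ[q].at (den-q^ (suc a)) 0
  rhs : ℤ[q].coeff ((ℤ.1ℤ ∷ []) ℤ[q].*ᴾ D) 0 ≡ ℤ[q].coeff D 0
  rhs = ℤ[q].at (ℤ[q].*ᴾ-identityˡ D) 0
  lhs : ℤ[q].coeff ((X ℤ[q].*ᴾ N) ℤ[q].*ᴾ (ℤ.1ℤ ∷ [])) 0 ≡ ℤ.0ℤ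
  lhs = ≡.trans (ℤ[q].at (ℤ[q]R.*-identityʳ (X ℤ[q].*ᴾ N)) 0)
    (≡.trans (ℤ[q].coeff-+ (ℤ.0ℤ ℤ[q].· N) _ 0)
             (≡.trans (ℤₚ.+-identityʳ _) (ℤ[q].at (ℤ[q].0·p N) 0)))

q≉0 : ¬ (q ≈ 0#)
q≉0 e = contradiction (ℤ[q].at (ℚ⟨q⟩.cross e) 1) λ ()

-- Rook numbers as the sequence ρ

-- With these arguments the polynomial hitPoly m n is hitPolynomial m n μ by
-- definition.
module _ (μ : Partition) where

  open QCalculus.HitNumbers (QIntegers.qfield K q _⁻¹ ⁻¹-inverseʳ q^suc≉1)
    q≉0 q^_ (λ _ → KR.refl) (λ _ → KR.refl)
    (q^ (ℤ.- + ∣ μ ∣)) (λ i → R i μ) (λ i → (- 1#) ^ i)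
    public using (hit-identity-top; hit-identity-lower)

lemma4p3 : (m n : ℕ) → n ≤ m → (μ : Partition) → Inside n m μ →
    let k = ℓ μ in
    ( [ m ∸ k choose n ∸ k ] * H□ (m ℕ.+ n ∸ k) k μ
    ≈ q^ (+ k ℤ.* (+ n ℤ.- + k)) * [ m ℕ.+ n ∸ 2 ℕ.* k ]↓ (m ∸ k) * H m n k μ )
    ×
    ( (r : ℕ) → r < k →
    [ m ∸ r choose n ∸ r ] * H□ (m ℕ.+ n ∸ r ∸ 1) r μ
    ≈ q^ (+ r ℤ.* (+ n ℤ.- + r ℤ.- + 1))
    * [ m ℕ.+ n ∸ 2 ℕ.* r ∸ 1 ]↓ (m ∸ r ∸ 1) * H m n r μ
    + ( ∑[ j ∈ range (suc r) n ]
    q^ (+ r ℤ.* (+ n ℤ.- + 1 ℤ.- + j)) * [ j choose r ]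
    * ([ m ℕ.+ n ∸ r ∸ j ∸ 1 ]↓ (m ∸ r) / [ n ∸ r ]) * H m n j μ ) )
lemma4p3 m n n≤m μ (k≤n , _) =
  hit-identity-top μ k≤n n≤m (λ i → R-zero i μ) ,
  λ r r<k → hit-identity-lower μ (ℕₚ.<-≤-trans r<k k≤n) n≤m (λ i n<i → R-zero i μ (ℕₚ.≤-<-trans k≤n n<i))
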